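{- Let $n\ge1$ and $1\le k\le n$, and let $(\mathcal C,\partial)$ be the chain complex defined below, supported on $\Pi(n,k)$. Then for each $i$, $H_i(\mathcal C,\partial;\mathbb Z)$ is a free abelian group with a basis given by the homology classes of the weakly increasing words of $\mathcal A(n,k)$ having rank $i$ (each of which is a cycle). Furthermore $$\sum_{i\ge0}\dim H_i(\mathcal C,\partial;\mathbb Z)\,q^i=\binom{n-1-\lfloor k/2\rfloor}{\lfloor (k-1)/2\rfloor}_{q^2}.$$
   Context: An RG-word of length $n$ with maximum letter $k$ is a word $w=w_1\cdots w_n$ of positive integers with $w_1=1$, $w_i\le\max(w_1,\dots,w_{i-1})+1$ for $2\le i\le n$, and $\max_iw_i=k$; $\mathcal R(n,k)$ is their set. $w$ is allowable if each even letter of $w$ occurs exactly once; $\mathcal A(n,k)$ is the set of allowable words. $\Pi(n,k)$ is the poset on $\mathcal R(n,k)$ generated by covers $v\lessdot w$ when $w$ arises from $v$ by increasing exactly one entry by $1$; it is graded with rank of $w$ equal to $\sum_iw_i-n-\binom k2$. The chain complex: $\mathcal C_i$ is the free abelian group with basis the rank-$i$ elements of $\Pi(n,k)$; for $w\in\mathcal R(n,k)$ let $E(w)=\{i: w_i\text{ is even and } w_j=w_i\text{ for some } j<i\}=\{i_1<\dots<i_r\}$, and set $\partial(w)=\sum_{j=1}^r(-1)^{j-1}\,w_1\cdots w_{i_j-1}(w_{i_j}-1)w_{i_j+1}\cdots w_n$ (extended linearly); $\partial^2=0$. The Gaussian binomial is $\binom{a}{b}_x=\frac{[a]_x!}{[b]_x![a-b]_x!}$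 with $[m]_x=1+x+\dots+x^{m-1}$, $[m]_x!=[1]_x\cdots[m]_x$; here $x=q^2$. -}

module Defs where

open import Data.Bool using (Bool; true; false; _∧_; _∨_; not; if_then_else_)
open import Data.Nat as ℕ using (ℕ; zero; suc; _∸_; _⊔_; _≡ᵇ_; _<ᵇ_; _≤ᵇ_)
open import Data.Nat.DivMod using (_%_; _/_)
open import Data.Nat.Combinatorics using (_C_)
open import Data.Integer as ℤ using (ℤ)
open import Data.List using (List; []; _∷_; _++_; [_]; map; filter; length; lookup; concatMap; upTo; foldr; tabulate; applyUpTo; replicate)
open import Data.List.Properties using (≡-dec)
open import Data.Fin using (Fin)
open import Data.Product using (_×_; _,_; Σ-syntax)
open import Relation.Nullary.Decidable using (does)
open import Data.Bool.Properties using () renaming (_≟_ to _≟B_)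
open import Relation.Binary.PropositionalEquality using (_≡_)

Word : Set
Word = List ℕ

evenᵇ : ℕ → Bool
evenᵇ a = (a % 2) ≡ᵇ 0

_==_ : Word → Word → Bool
u == v = does (≡-dec ℕ._≟_ u v)

memᵇ : ℕ → Word → Bool
memᵇ a [] = false
memᵇ a (b ∷ w) = (a ≡ᵇ b) ∨ memᵇ a w

countᵇ : ℕ → Word → ℕ
countᵇ a [] = 0
countᵇ a (b ∷ w) = (if a ≡ᵇ b then 1 else 0) ℕ.+ countᵇ a w

maxLetter : Word → ℕ
maxLetter = foldr _⊔_ 0

sumℕ : List ℕ → ℕ
sumℕ = foldr ℕ._+_ 0

-- restricted growth condition: scanning with m = max of the letters so far
-- (m = 0 before the first letter), each letter a satisfies 1 ≤ a ≤ m + 1.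
-- For the first letter this forces w₁ = 1.
rgFrom : ℕ → Word → Bool
rgFrom m [] = true
rgFrom m (a ∷ w) = (1 ≤ᵇ a) ∧ (a ≤ᵇ suc m) ∧ rgFrom (m ⊔ a) w

isRG : Word → Bool
isRG = rgFrom 0

allowableᵇ : Word → Bool
allowableᵇ w = foldr (λ a b → (not (evenᵇ a) ∨ (countᵇ a w ≡ᵇ 1)) ∧ b) true w

weaklyIncᵇ : Word → Bool
weaklyIncᵇ [] = true
weaklyIncᵇ (a ∷ []) = true
weaklyIncᵇ (a ∷ b ∷ w) = (a ≤ᵇ b) ∧ weaklyIncᵇ (b ∷ w)

wordsOver : ℕ → ℕ → List Word
wordsOver m zero = [ [] ]
wordsOver m (suc len) =
  concatMap (λ a → map (a ∷_) (wordsOver m len)) (applyUpTo suc m)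

select : (Word → Bool) → List Word → List Word
select p = filter (λ w → p w ≟B true)

-- R(n,k): RG-words of length n with maximum letter k
-- (every RG-word of length n has letters ≤ n, so wordsOver n n contains them all)
R : ℕ → ℕ → List Word
R n k = select (λ w → isRG w ∧ (maxLetter w ≡ᵇ k)) (wordsOver n n)

rank : ℕ → ℕ → Word → ℕ
rank n k w = sumℕ w ∸ n ∸ (k C 2)

-- basis of C_i : the rank-i elements of Π(n,k)
B : ℕ → ℕ → ℕ → List Word
B n k i = select (λ w → rank n k w ≡ᵇ i) (R n k)

W : ℕ → ℕ → ℕ → List Word
W n k i = select (λ w → allowableᵇ w ∧ weaklyIncᵇ w) (B n k i)

-- The differential on a single word, as a formal ℤ-combination of words.
-- Scan w left to right keeping the prefix; position p is in E(w) iff w_p is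
-- even and occurs in the prefix. The j-th such position contributes
-- (-1)^(j-1) · (w with that entry decreased by 1).

∂go : Word → Word → ℤ → List (ℤ × Word)
∂go pre [] s = []
∂go pre (a ∷ rest) s =
  if evenᵇ a ∧ memᵇ a pre
  then (s , pre ++ ((a ∸ 1) ∷ rest)) ∷ ∂go (pre ++ [ a ]) rest (ℤ.- s)
  else ∂go (pre ++ [ a ]) rest s

∂word : Word → List (ℤ × Word)
∂word w = ∂go [] w (ℤ.+ 1)

coeffIn : Word → List (ℤ × Word) → ℤ
coeffIn v [] = ℤ.+ 0
coeffIn v ((c , u) ∷ L) = (if u == v then c else ℤ.+ 0) ℤ.+ coeffIn v L

Σℤ : List ℤ → ℤ
Σℤ = foldr ℤ._+_ (ℤ.+ 0)

-- A chain supported on a list of basis words L is a coefficient vector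
-- Fin (length L) → ℤ.  toFun gives its coefficient on an arbitrary word.
Coeffs : List Word → Set
Coeffs L = Fin (length L) → ℤ

toFun : (L : List Word) → Coeffs L → Word → ℤ
toFun L c v = Σℤ (tabulate (λ j → if lookup L j == v then c j else ℤ.+ 0))

∂chain : (L : List Word) → Coeffs L → Word → ℤ
∂chain L c v = Σℤ (tabulate (λ j → c j ℤ.* coeffIn v (∂word (lookup L j))))

IsCycle : (n k i : ℕ) → Coeffs (B n k i) → Set
IsCycle n k i z = ∀ v → ∂chain (B n k i) z v ≡ ℤ.+ 0

Homologous : (n k i : ℕ) → (Word → ℤ) → (Word → ℤ) → Set
Homologous n k i f g =
  Σ[ b ∈ Coeffs (B n k (suc i)) ] (∀ v → f v ℤ.- g v ≡ ∂chain (B n k (suc i)) b v)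

-- Power series / polynomials with ℕ coefficients, as coefficient functions

Poly : Set
Poly = ℕ → ℕ

sumUpTo : ℕ → (ℕ → ℕ) → ℕ
sumUpTo m f = sumℕ (map f (upTo m))

_⊛_ : Poly → Poly → Poly
(f ⊛ g) i = sumUpTo (suc i) (λ j → f j ℕ.* g (i ∸ j))

onePoly : Poly
onePoly zero = 1
onePoly (suc _) = 0

qInt : ℕ → Poly
qInt m j = if j <ᵇ m then 1 else 0

qFact : ℕ → Poly
qFact zero = onePoly
qFact (suc m) = qFact m ⊛ qInt (suc m)

-- substitution x = q² :  (sq f)(q) = f(q²)
sq : Poly → Poly
sq f i = if evenᵇ i then f (i / 2) else 0

-- Poincaré polynomial Σ_i |W_i| q^i (|W_i| = size of the basis of H_i)
poincare : ℕ → ℕ → Poly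
poincare n k i = length (W n k i)

{-# OPTIONS --safe #-}

-- In an RG-word every letter is either a first occurrence, whose position and value ∂ never changes, or lies between
-- 1 and the running maximum m. So the complex splits into tensor products of the small complexes ∂(2j) = 2j - 1 on
-- the letters 1, …, m, which are contractible for m even and have homology spanned by m for m odd.
-- Explicitly: skip the first occurrences and the odd letters equal to the running maximum, and let h raise the next
-- letter by one if it is odd and kill the word if it is even. Then ∂h + h∂ = 1 - π, where π is the projection onto the
-- words in which every letter is skipped, and these are the weakly increasing allowable words.
-- Such a word is determined by how the N = n - k letters which are no first occurrences
-- are distributed, each 2p + 1 among them contributing x^p; this gives the Pascal recursion of the Gaussian binomial.
module Submission where

open import Defs
open import Data.Bool using (Bool; true; false; if_then_else_; not; _∧_; _∨_; T)
open import Data.Bool.Properties using (⇔→≡; T-≡; T-∨; ∧-zeroʳ; ∨-identityʳ; ∨-assoc; not-involutive; ¬-not) renaming (_≟_ to _≟B_)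
open import Data.Empty using (⊥)
open import Data.Fin using (Fin; zero; suc)
open import Data.Integer using (ℤ; 0ℤ; 1ℤ) renaming (_+_ to _+ℤ_; _*_ to _*ℤ_; _-_ to _-ℤ_; -_ to negℤ)
import Data.Integer.Properties as ℤₚ
import Data.Integer.Tactic.RingSolver as ℤ-Solver
open import Data.List using (List; []; _∷_; _++_; [_]; length; lookup; foldr; tabulate; map; concatMap; applyUpTo; cartesianProductWith)
open import Data.List.Membership.Propositional using (_∈_)
open import Data.List.Membership.Propositional.Properties
open import Data.List.Membership.Propositional.Properties.WithK using (unique∧set⇒bag)
open import Data.List.Properties using (++-assoc; ≡-dec; ∷-injective; ∷-injectiveʳ; length-map; length-++; map-upTo)
open import Data.List.Relation.Binary.BagAndSetEquality using (∼bag⇒↭)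
open import Data.List.Relation.Binary.Permutation.Propositional.Properties using (↭-length)
open import Data.List.Relation.Unary.All as All using (All; []; _∷_)
open import Data.List.Relation.Unary.AllPairs using ([]; _∷_)
open import Data.List.Relation.Unary.Any using (here; there; index)
open import Data.List.Relation.Unary.Any.Properties using (lookup-index)
open import Data.List.Relation.Unary.Unique.Propositional using (Unique)
import Data.List.Relation.Unary.Unique.Propositional.Properties as Unique
open import Data.Nat using (ℕ; zero; suc; _+_; _*_; _∸_; _/_; _⊔_; _<ᵇ_; _≡ᵇ_; _≤ᵇ_; _≤_; _<_; z≤n; s≤s; s≤s⁻¹; _<?_; _≟_)
open import Data.Nat.Combinatorics using (_C_; nCk+nC[k+1]≡[n+1]C[k+1]; nC1≡n)
open import Data.Nat.DivMod using (+-distrib-/-∣ˡ)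
open import Data.Nat.Divisibility using (divides)
open import Data.Nat.Properties
open import Data.Nat.Tactic.RingSolver using (solve-∀)
open import Data.Product using (_×_; _,_; ∃; Σ-syntax; proj₁; proj₂)
open import Data.Sum using (inj₁; inj₂)
open import Function using (_∘_; mk⇔; Equivalence)
open import Relation.Nullary using (yes; no; contradiction)
open import Relation.Nullary.Decidable using (dec-true; dec-false)
open import Relation.Binary.PropositionalEquality hiding ([_])
import Relation.Binary.Reasoning.Setoid as SetoidReasoning
open import Algebra.Properties.CommutativeSemigroup +-commutativeSemigroup using (interchange; x∙yz≈y∙xz)
open import Algebra.Properties.Semiring.Sum ℤₚ.+-*-semiring using (sum; *-distribˡ-sum; sum-cong-≗; ∑-comm)

-- The homotopy on a single word

T⇒≡ : ∀ {b} → T b → b ≡ true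
T⇒≡ = Equivalence.to T-≡

≡⇒T : ∀ {b} → b ≡ true → T b
≡⇒T = Equivalence.from T-≡

T-ext : ∀ {b c} → (T b → T c) → (T c → T b) → b ≡ c
T-ext f g = ⇔→≡ (mk⇔ (T⇒≡ ∘ f ∘ ≡⇒T) (T⇒≡ ∘ g ∘ ≡⇒T))

∧-true⁻ : ∀ {b c} → b ∧ c ≡ true → b ≡ true × c ≡ true
∧-true⁻ {true} e = refl , e

evenᵇ-suc : ∀ a → evenᵇ (suc a) ≡ not (evenᵇ a)
evenᵇ-suc zero          = refl
evenᵇ-suc (suc zero)    = refl
evenᵇ-suc (suc (suc a)) = evenᵇ-suc a

-- The role of a letter a after a prefix with maximum m: skipped by h, raised by h, or lowered by ∂.
data Kind : Set where
  critical low repeated : Kind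

data KindView (m : ℕ) : ℕ → Kind → Set where
  is-fresh    : ∀ {a} → m < a → KindView m a critical
  is-top      : evenᵇ m ≡ false → KindView m m critical
  is-low      : ∀ {a} → evenᵇ a ≡ false → a < m → KindView m a low
  is-repeated : ∀ {a} → evenᵇ a ≡ true → a ≤ m → KindView m a repeated

-- Abstract, so that occurrences of kind m a stay visible to with and rewrite.
abstract
  kind : ℕ → ℕ → Kind
  kind m a with m <? a
  ... | yes _ = critical
  ... | no _ with evenᵇ a | a ≟ m
  ...   | true  | _     = repeated
  ...   | false | yes _ = critical
  ...   | false | no _  = low

  kindView : ∀ m a → KindView m a (kind m a)
  kindView m a with m <? a
  ... | yes m<a = is-fresh m<a
  ... | no m≮a with evenᵇ a in e | a ≟ m
  ...   | true  | _        = is-repeated e (≮⇒≥ m≮a)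
  ...   | false | yes refl = is-top e
  ...   | false | no a≢m   = is-low e (≤∧≢⇒< (≮⇒≥ m≮a) a≢m)

-- The constructors exclude each other by parity or by order, except `is-fresh` and `is-top`, which
-- agree in kind. Since `kind` is abstract, its values are found from a view in this way.
kind-unique : ∀ {m a κ λ′} → KindView m a κ → KindView m a λ′ → κ ≡ λ′
kind-unique (is-fresh _)      (is-fresh _)      = refl
kind-unique (is-fresh p)      (is-top _)        = refl
kind-unique (is-fresh p)      (is-low _ q)      = contradiction (<-trans p q) (<-irrefl refl)
kind-unique (is-fresh p)      (is-repeated _ q) = contradiction (<-≤-trans p q) (<-irrefl refl)
kind-unique (is-top _)        (is-fresh _)      = refl
kind-unique (is-top _)        (is-top _)        = refl
kind-unique (is-top _)        (is-low _ q)      = contradiction q (<-irrefl refl)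
kind-unique (is-top e)        (is-repeated e′ _) with () ← trans (sym e) e′
kind-unique (is-low _ p)      (is-fresh q)      = contradiction (<-trans p q) (<-irrefl refl)
kind-unique (is-low _ p)      (is-top _)        = contradiction p (<-irrefl refl)
kind-unique (is-low _ _)      (is-low _ _)      = refl
kind-unique (is-low e _)      (is-repeated e′ _) with () ← trans (sym e) e′
kind-unique (is-repeated _ p) (is-fresh q)      = contradiction (<-≤-trans q p) (<-irrefl refl)
kind-unique (is-repeated e _) (is-top e′)       with () ← trans (sym e) e′
kind-unique (is-repeated e _) (is-low e′ _)     with () ← trans (sym e) e′
kind-unique (is-repeated _ _) (is-repeated _ _) = refl

kind-≡ : ∀ {m a κ} → KindView m a κ → kind m a ≡ κ
kind-≡ {m} {a} = kind-unique (kindView m a)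

kind-view : ∀ {m a κ} → kind m a ≡ κ → KindView m a κ
kind-view {m} {a} refl = kindView m a

-- An even letter a + 1 ≤ m has an odd predecessor below m, never the top letter. With `low-suc`
-- this makes lowering and raising mutually inverse between `low` and `repeated` letters.
repeated-pred : ∀ {m a} → kind m (suc a) ≡ repeated → kind m a ≡ low
repeated-pred {a = a} e with is-repeated e′ a<m ← kind-view e =
  kind-≡ (is-low (trans (sym (not-involutive _)) (cong not (trans (sym (evenᵇ-suc a)) e′))) a<m)

low-suc : ∀ {m a} → kind m a ≡ low → kind m (suc a) ≡ repeated
low-suc {a = a} e with is-low e′ a<m ← kind-view e =
  kind-≡ (is-repeated (trans (evenᵇ-suc a) (cong not e′)) a<m)

repeated-⊔ : ∀ {m a} → kind m a ≡ repeated → m ⊔ a ≡ m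
repeated-⊔ e with is-repeated _ a≤m ← kind-view e = m≥n⇒m⊔n≡m a≤m

low-⊔ : ∀ {m a} → kind m a ≡ low → m ⊔ a ≡ m
low-⊔ e with is-low _ a<m ← kind-view e = m≥n⇒m⊔n≡m (<⇒≤ a<m)

branch : ∀ {A : Set} → Kind → A → A → A → A
branch critical x y z = x
branch low      x y z = y
branch repeated x y z = z

-- D m w φ and H m w φ are the values at ∂w and h(w) of the linear extension of φ, where w is read after a prefix
-- with maximum m. Working with functionals on words avoids formal sums.
D : ℕ → Word → (Word → ℤ) → ℤ
D m []      φ = 0ℤ
D m (a ∷ w) φ = branch (kind m a) rest rest (φ ((a ∸ 1) ∷ w) -ℤ rest)
  where rest = D (m ⊔ a) w (φ ∘ (a ∷_))

H : ℕ → Word → (Word → ℤ) → ℤ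
H m []      φ = 0ℤ
H m (a ∷ w) φ = branch (kind m a) (H (m ⊔ a) w (φ ∘ (a ∷_))) (φ (suc a ∷ w)) 0ℤ

criticalᵇ : ℕ → Word → Bool
criticalᵇ m []      = true
criticalᵇ m (a ∷ w) = branch (kind m a) (criticalᵇ (m ⊔ a) w) false false

-- The projection π, dualised like `D` and `H`.
P : ℕ → Word → (Word → ℤ) → ℤ
P m w φ = if criticalᵇ m w then φ w else 0ℤ

-- A term of ∂w has the length of w, and its letters are those of w except for one repeated letter
-- lowered by 1. So φ matters only on such words, which later confines ∂ to a finite list.
D-local : ∀ {Q : ℕ → Set} → (∀ {m a} → kind m a ≡ repeated → Q a → Q (a ∸ 1)) →
          ∀ m {w φ ψ} → All Q w →
          (∀ u → length u ≡ length w → All Q u → φ u ≡ ψ u) → D m w φ ≡ D m w ψ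
D-local Q-pred m []                 p = refl
D-local Q-pred m {a ∷ w} (q ∷ qs) p with kind m a in e
... | critical = D-local Q-pred (m ⊔ a) qs λ u l qs′ → p (a ∷ u) (cong suc l) (q ∷ qs′)
... | low      = D-local Q-pred (m ⊔ a) qs λ u l qs′ → p (a ∷ u) (cong suc l) (q ∷ qs′)
... | repeated = cong₂ _-ℤ_ (p _ refl (Q-pred e q ∷ qs))
                   (D-local Q-pred (m ⊔ a) qs λ u l qs′ → p (a ∷ u) (cong suc l) (q ∷ qs′))

D-cong : ∀ m w {φ ψ} → φ ≗ ψ → D m w φ ≡ D m w ψ
D-cong m w p = D-local {λ a → a ≡ a} (λ _ _ → refl) m (All.universal (λ _ → refl) w) λ u _ _ → p u

D-zero : ∀ m w → D m w (λ _ → 0ℤ) ≡ 0ℤ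
D-zero m []      = refl
D-zero m (a ∷ w) with kind m a
... | critical = D-zero (m ⊔ a) w
... | low      = D-zero (m ⊔ a) w
... | repeated = cong (0ℤ -ℤ_) (D-zero (m ⊔ a) w)

-- Functionals compose in reverse: the first summand is φ at h(∂w), the second φ at ∂(h(w)). A
-- critical head passes to the tail. At a low head, lowering the raised letter restores w and the
-- remaining terms cancel; at a repeated head h∂ alone restores w. Positivity excludes the letter 0,
-- whose truncated predecessor is 0 again.
homotopy : ∀ m {w} → All (1 ≤_) w → ∀ φ →
           φ w -ℤ P m w φ ≡ D m w (λ u → H m u φ) +ℤ H m w (λ u → D m u φ)
homotopy m []                         φ = ℤₚ.+-inverseʳ (φ [])
homotopy m {suc a ∷ w} (s≤s _ ∷ pos) φ with kind m (suc a) in e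
... | critical = homotopy (m ⊔ suc a) pos (φ ∘ (suc a ∷_))
... | low rewrite low-suc e | low-⊔ e | repeated-⊔ (low-suc e) =
      lemma (φ (suc a ∷ w)) (D m w (φ ∘ (suc (suc a) ∷_)))
  where
  lemma : ∀ x y → x -ℤ 0ℤ ≡ y +ℤ (x -ℤ y)
  lemma = ℤ-Solver.solve-∀
... | repeated rewrite repeated-pred e | repeated-⊔ e | D-zero m w =
      sym (ℤₚ.+-identityʳ _)

-- Lowering a repeated letter leaves a low one, and lowering a later letter keeps the repeated one,
-- so no term of ∂w is critical: π∂ = 0.
D-P : ∀ m w φ → D m w (λ u → P m u φ) ≡ 0ℤ
D-P m []      φ = refl
D-P m (a ∷ w) φ with kind m a in e
... | critical = D-P (m ⊔ a) w (φ ∘ (a ∷_))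
... | low = D-zero (m ⊔ a) w
... | repeated rewrite D-zero (m ⊔ a) w = trans (ℤₚ.+-identityʳ _) (head a e)
  where
  head : ∀ a → kind m a ≡ repeated → P m ((a ∸ 1) ∷ w) φ ≡ 0ℤ
  -- The truncated predecessor of 0 is 0, which is again repeated.
  head zero    e rewrite e = refl
  head (suc a) e rewrite repeated-pred e = refl

-- A critical word has no repeated letter for ∂ to lower.
critical-D : ∀ m w φ → criticalᵇ m w ≡ true → D m w φ ≡ 0ℤ
critical-D m []      φ c = refl
critical-D m (a ∷ w) φ c with kind m a
... | critical = critical-D (m ⊔ a) w (φ ∘ (a ∷_)) c

-- RG-words and their excess

-- n letters, continuing an RG-word with maximum m to one with maximum k. The excess i adds up a - 1 over the letters
-- a that are no first occurrences; for m = 0 it is the rank.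
data RG : (m k n i : ℕ) → Word → Set where
  end : ∀ {m} → RG m m 0 0 []
  new : ∀ {m k n i w} → RG (suc m) k n i w → RG m k (suc n) i (suc m ∷ w)
  old : ∀ {m k n i a w} → a < m → RG m k n i w → RG m k (suc n) (a + i) (suc a ∷ w)

m⊔1+m : ∀ m → m ⊔ suc m ≡ suc m
m⊔1+m m = m≤n⇒m⊔n≡n (n≤1+n m)

kind-new : ∀ m → kind m (suc m) ≡ critical
kind-new m = kind-≡ (is-fresh ≤-refl)

-- Raising a low letter keeps it at most m, so first occurrences, length and final maximum survive
-- while the excess grows by one. Hence h maps rank i to rank i + 1.
H-local : ∀ {m k n i w φ ψ} → RG m k n i w →
          (∀ u → RG m k n (suc i) u → φ u ≡ ψ u) → H m w φ ≡ H m w ψ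
H-local end p = refl
H-local {m} (new r) p rewrite kind-new m | m⊔1+m m = H-local r λ u r′ → p _ (new r′)
H-local {m} {k} (old {n = n} {a = a} {w = w} a<m r) p with kind m (suc a) in e
... | critical rewrite m≥n⇒m⊔n≡m a<m =
      H-local r λ u r′ → p _ (subst (λ i → RG m k (suc n) i (suc a ∷ u)) (+-suc a _) (old a<m r′))
... | low with is-low _ 1+a<m ← kind-view e = p _ (old 1+a<m r)
... | repeated = refl

-- The bound m + n, rather than k, is the one that places the word in `wordsOver n n` once m = 0.
RG-letters : ∀ {m k n i w} → RG m k n i w → All (λ a → 1 ≤ a × a ≤ m + n) w
RG-letters end = []
RG-letters {m} {n = suc n} (new {w = w} r) =
  (s≤s z≤n , ≤-trans (m≤m+n (suc m) n) (≤-reflexive (sym (+-suc m n)))) ∷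
  subst (λ N → All (λ a → 1 ≤ a × a ≤ N) w) (sym (+-suc m n)) (RG-letters r)
RG-letters {m} {n = suc n} (old a<m r) =
  (s≤s z≤n , ≤-trans a<m (m≤m+n m (suc n))) ∷
  All.map (λ (p , q) → p , ≤-trans q (+-monoʳ-≤ m (n≤1+n n))) (RG-letters r)

RG-length : ∀ {m k n i w} → RG m k n i w → length w ≡ n
RG-length end       = refl
RG-length (new r)   = cong suc (RG-length r)
RG-length (old _ r) = cong suc (RG-length r)

RG-maxLetter : ∀ {m k n i w} → RG m k n i w → m ⊔ maxLetter w ≡ k
RG-maxLetter {m} end = ⊔-identityʳ m
RG-maxLetter {m} (new {w = w} r) =
  trans (sym (⊔-assoc m (suc m) (maxLetter w))) (trans (cong (_⊔ maxLetter w) (m⊔1+m m)) (RG-maxLetter r))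
RG-maxLetter {m} (old {a = a} {w = w} a<m r) =
  trans (sym (⊔-assoc m (suc a) (maxLetter w))) (trans (cong (_⊔ maxLetter w) (m≥n⇒m⊔n≡m a<m)) (RG-maxLetter r))

RG-rgFrom : ∀ {m k n i w} → RG m k n i w → rgFrom m w ≡ true
RG-rgFrom end = refl
RG-rgFrom {m} (new r) rewrite T⇒≡ (<⇒<ᵇ (n<1+n m)) | m⊔1+m m = RG-rgFrom r
RG-rgFrom {m} (old {a = a} a<m r) rewrite T⇒≡ (<⇒<ᵇ (m≤n⇒m≤1+n a<m)) | m≥n⇒m⊔n≡m a<m = RG-rgFrom r

rgFrom-RG : ∀ m w → rgFrom m w ≡ true → ∃ λ i → RG m (m ⊔ maxLetter w) (length w) i w
rgFrom-RG m []          _ = 0 , subst (λ k → RG m k 0 0 []) (sym (⊔-identityʳ m)) end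
rgFrom-RG m (suc a ∷ w) e with ∧-true⁻ {a <ᵇ suc m} e
... | e₁ , e₂ with rgFrom-RG (m ⊔ suc a) w e₂ | m≤n⇒m<n∨m≡n (s≤s⁻¹ (<ᵇ⇒< a (suc m) (≡⇒T e₁)))
...   | i , r | inj₁ a<m =
        a + i , subst (λ k → RG m k (suc (length w)) (a + i) (suc a ∷ w)) (⊔-assoc m (suc a) (maxLetter w))
                  (old a<m (subst (λ m′ → RG m′ (m ⊔ suc a ⊔ maxLetter w) (length w) i w) (m≥n⇒m⊔n≡m a<m) r))
...   | i , r | inj₂ refl =
        i , subst (λ k → RG m k (suc (length w)) i (suc m ∷ w)) (⊔-assoc m (suc m) (maxLetter w))
              (new (subst (λ m′ → RG m′ (m ⊔ suc m ⊔ maxLetter w) (length w) i w) (m⊔1+m m) r))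

-- A first occurrence m + 1 pays 1 for the length and m for the passage from m C 2 to (m + 1) C 2,
-- by Pascal. The additive form avoids truncated subtraction.
RG-sum : ∀ {m k n i w} → RG m k n i w → sumℕ w + m C 2 ≡ n + (k C 2 + i)
RG-sum {m} end = sym (+-identityʳ _)
RG-sum {m} {k} {suc n} {i} (new {w = w} r) = cong suc (begin
  m + sumℕ w + m C 2        ≡⟨ lemma m (sumℕ w) (m C 2) ⟩
  sumℕ w + (m + m C 2)      ≡⟨ cong (λ x → sumℕ w + (x + m C 2)) (nC1≡n m) ⟨
  sumℕ w + (m C 1 + m C 2)  ≡⟨ cong (sumℕ w +_) (nCk+nC[k+1]≡[n+1]C[k+1] m 1) ⟩
  sumℕ w + suc m C 2        ≡⟨ RG-sum r ⟩
  n + (k C 2 + i)           ∎)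
  where
  open ≡-Reasoning
  lemma : ∀ x y z → x + y + z ≡ y + (x + z)
  lemma = solve-∀
RG-sum {m} {k} {suc n} (old {i = i} {a = a} {w = w} _ r) = cong suc (begin
  a + sumℕ w + m C 2     ≡⟨ +-assoc a _ _ ⟩
  a + (sumℕ w + m C 2)   ≡⟨ cong (a +_) (RG-sum r) ⟩
  a + (n + (k C 2 + i))  ≡⟨ lemma a n (k C 2) i ⟩
  n + (k C 2 + (a + i))  ∎)
  where
  open ≡-Reasoning
  lemma : ∀ a b c d → a + (b + (c + d)) ≡ b + (c + (a + d))
  lemma = solve-∀

RG-rank : ∀ {k n i w} → RG 0 k n i w → rank n k w ≡ i
RG-rank {k} {n} {i} {w} r = begin
  sumℕ w ∸ n ∸ k C 2           ≡⟨ cong (λ s → s ∸ n ∸ k C 2) (trans (sym (+-identityʳ _)) (RG-sum r)) ⟩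
  n + (k C 2 + i) ∸ n ∸ k C 2  ≡⟨ cong (_∸ k C 2) (m+n∸m≡n n _) ⟩
  k C 2 + i ∸ k C 2            ≡⟨ m+n∸m≡n (k C 2) i ⟩
  i                            ∎
  where open ≡-Reasoning

-- The differential as a functional

δ : Word → Word → ℤ
δ v u = if u == v then 1ℤ else 0ℤ

memᵇ-∷ʳ : ∀ b pre a → memᵇ b (pre ++ [ a ]) ≡ memᵇ b pre ∨ (b ≡ᵇ a)
memᵇ-∷ʳ b []        a = ∨-identityʳ _
memᵇ-∷ʳ b (c ∷ pre) a = trans (cong ((b ≡ᵇ c) ∨_) (memᵇ-∷ʳ b pre a)) (sym (∨-assoc (b ≡ᵇ c) _ _))

<ᵇ-suc : ∀ b m → ((b <ᵇ m) ∨ (b ≡ᵇ m)) ≡ (b <ᵇ suc m)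
<ᵇ-suc zero    zero    = refl
<ᵇ-suc zero    (suc m) = refl
<ᵇ-suc (suc b) zero    = refl
<ᵇ-suc (suc b) (suc m) = <ᵇ-suc b m

<ᵇ-absorb : ∀ {a m} b → a < m → ((b <ᵇ m) ∨ (b ≡ᵇ a)) ≡ (b <ᵇ m)
<ᵇ-absorb {a} {m} b a<m = T-ext to (Equivalence.from T-∨ ∘ inj₁)
  where
  to : T ((b <ᵇ m) ∨ (b ≡ᵇ a)) → T (b <ᵇ m)
  to t with Equivalence.to (T-∨ {b <ᵇ m}) t
  ... | inj₁ b<m = b<m
  ... | inj₂ b≡a rewrite ≡ᵇ⇒≡ b a b≡a = <⇒<ᵇ a<m

-- The hypothesis on `pre` says that its positive letters are exactly 1, ..., m, so membership in
-- E(w) means even and at most m, that is `repeated`. The sign flip after each such position is the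
-- subtraction in `D`.
coeffIn-∂go : ∀ {m k n i w} → RG m k n i w → ∀ v pre s → (∀ b → memᵇ (suc b) pre ≡ (b <ᵇ m)) →
              coeffIn v (∂go pre w s) ≡ s *ℤ D m w (λ u → δ v (pre ++ u))
coeffIn-∂go end v pre s mem = sym (ℤₚ.*-zeroʳ s)
coeffIn-∂go {m} (new {w = w} r) v pre s mem
  -- The letter m + 1 is absent from the prefix, so its position is not in E(w).
  rewrite mem m | ¬-not {m <ᵇ m} (λ e → <-irrefl refl (<ᵇ⇒< m m (≡⇒T e)))
        | ∧-zeroʳ (evenᵇ (suc m)) | kind-new m | m⊔1+m m =
  trans (coeffIn-∂go r v (pre ++ [ suc m ]) s
          (λ b → trans (memᵇ-∷ʳ (suc b) pre (suc m)) (trans (cong (_∨ (b ≡ᵇ m)) (mem b)) (<ᵇ-suc b m))))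
        (cong (s *ℤ_) (D-cong (suc m) w λ u → cong (δ v) (++-assoc pre [ suc m ] u)))
coeffIn-∂go {m} (old {a = a} {w = w} a<m r) v pre s mem
  rewrite mem a | T⇒≡ (<⇒<ᵇ a<m) | m≥n⇒m⊔n≡m a<m = go
  where
  rest = D m w (λ u → δ v (pre ++ (suc a ∷ u)))

  ih : ∀ s → coeffIn v (∂go (pre ++ [ suc a ]) w s) ≡ s *ℤ rest
  ih s = trans (coeffIn-∂go r v (pre ++ [ suc a ]) s
          (λ b → trans (memᵇ-∷ʳ (suc b) pre (suc a)) (trans (cong (_∨ (b ≡ᵇ a)) (mem b)) (<ᵇ-absorb b a<m))))
        (cong (s *ℤ_) (D-cong m w λ u → cong (δ v) (++-assoc pre [ suc a ] u)))

  scale : ∀ s t → (if t then s else 0ℤ) ≡ s *ℤ (if t then 1ℤ else 0ℤ)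
  scale s true  = sym (ℤₚ.*-identityʳ s)
  scale s false = sym (ℤₚ.*-zeroʳ s)

  lemma : ∀ s x y → s *ℤ x +ℤ (negℤ s) *ℤ y ≡ s *ℤ (x -ℤ y)
  lemma = ℤ-Solver.solve-∀

  go : coeffIn v (if evenᵇ (suc a) ∧ true
                  then (s , pre ++ (a ∷ w)) ∷ ∂go (pre ++ [ suc a ]) w (negℤ s)
                  else ∂go (pre ++ [ suc a ]) w s)
       ≡ s *ℤ branch (kind m (suc a)) rest rest (δ v (pre ++ (a ∷ w)) -ℤ rest)
  go with kind m (suc a) in e
  ... | critical with kind-view e
  ...   | is-fresh m<1+a = contradiction (<-≤-trans m<1+a a<m) (<-irrefl refl)
  ...   | is-top e′ rewrite e′ = ih s
  go | low with is-low e′ _ ← kind-view e rewrite e′ = ih s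
  go | repeated with is-repeated e′ _ ← kind-view e rewrite e′ =
    trans (cong₂ _+ℤ_ (scale s ((pre ++ (a ∷ w)) == v)) (ih (negℤ s))) (lemma s _ rest)

coeffIn-∂word : ∀ {k n i w} → RG 0 k n i w → ∀ v → coeffIn v (∂word w) ≡ D 0 w (δ v)
coeffIn-∂word {w = w} r v = trans (coeffIn-∂go r v [] 1ℤ (λ _ → refl)) (ℤₚ.*-identityˡ _)

-- Critical words are the weakly increasing allowable words

-- Allowability of the suffix w after a prefix in which each of 1, …, m occurs; 0 never occurs at all.
Sparse : ℕ → Word → Set
Sparse m w = ∀ a → evenᵇ a ≡ true → countᵇ a w ≤ 1 × (a ≤ m → countᵇ a w ≡ 0)

≡ᵇ-refl : ∀ a → (a ≡ᵇ a) ≡ true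
≡ᵇ-refl a = T⇒≡ (≡⇒≡ᵇ a a refl)

≢⇒≡ᵇ : ∀ {a b} → a ≢ b → (a ≡ᵇ b) ≡ false
≢⇒≡ᵇ {a} {b} a≢b = ¬-not (a≢b ∘ ≡ᵇ⇒≡ a b ∘ ≡⇒T)

≤⇒≤ᵇ-true : ∀ {a b} → a ≤ b → (a ≤ᵇ b) ≡ true
≤⇒≤ᵇ-true p = T⇒≡ (≤⇒≤ᵇ p)

-- A critical letter that is not fresh is the odd running maximum. So an even letter enters only as
-- a fresh one, and from then on the maximum excludes it.
critical⇒sparse : ∀ {m k n i w} → RG m k n i w → criticalᵇ m w ≡ true → Sparse m w
critical⇒sparse end c a e = z≤n , λ _ → refl
critical⇒sparse {m} (new {w = w} r) c a e rewrite kind-new m | m⊔1+m m with a ≟ suc m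
... | yes refl rewrite ≡ᵇ-refl m =
      ≤-reflexive (cong suc (proj₂ (critical⇒sparse r c a e) ≤-refl)) ,
      λ p → contradiction p (<-irrefl refl)
... | no a≢1+m rewrite ≢⇒≡ᵇ a≢1+m =
      proj₁ (critical⇒sparse r c a e) , λ a≤m → proj₂ (critical⇒sparse r c a e) (m≤n⇒m≤1+n a≤m)
critical⇒sparse {m} (old {a = b} b<m r) c a e with kind m (suc b) in ek
... | critical rewrite m≥n⇒m⊔n≡m b<m with kind-view ek
...   | is-fresh p = contradiction (<-≤-trans p b<m) (<-irrefl refl)
...   | is-top odd with a ≟ suc b
...     | yes refl with () ← trans (sym e) odd
...     | no a≢ rewrite ≢⇒≡ᵇ a≢ = critical⇒sparse r c a e

-- The leading m stands for the running maximum, which a critical letter equals or exceeds and then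
-- replaces.
critical⇒weaklyInc : ∀ {m k n i w} → RG m k n i w → criticalᵇ m w ≡ true → weaklyIncᵇ (m ∷ w) ≡ true
critical⇒weaklyInc end c = refl
critical⇒weaklyInc {m} (new r) c
  rewrite kind-new m | m⊔1+m m | ≤⇒≤ᵇ-true (n≤1+n m) = critical⇒weaklyInc r c
critical⇒weaklyInc {m} (old {a = a} a<m r) c with kind m (suc a) in ek
... | critical rewrite m≥n⇒m⊔n≡m a<m with kind-view ek
...   | is-fresh p = contradiction (<-≤-trans p a<m) (<-irrefl refl)
...   | is-top odd rewrite ≤⇒≤ᵇ-true (≤-refl {m}) = critical⇒weaklyInc r c

sparse⇒critical : ∀ {m k n i w} → RG m k n i w → Sparse m w → weaklyIncᵇ (m ∷ w) ≡ true → criticalᵇ m w ≡ true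
sparse⇒critical end s inc = refl
sparse⇒critical {m} (new {w = w} r) s inc rewrite kind-new m | m⊔1+m m =
  sparse⇒critical r s′ (proj₂ (∧-true⁻ inc))
  where
  s′ : Sparse (suc m) w
  s′ a e with s a e
  ... | p , q with a ≟ suc m
  ...   | yes refl rewrite ≡ᵇ-refl m = ≤-trans (n≤1+n _) p , λ _ → n≤0⇒n≡0 (s≤s⁻¹ p)
  ...   | no a≢ rewrite ≢⇒≡ᵇ a≢ = p , λ a≤1+m → q (s≤s⁻¹ (≤∧≢⇒< a≤1+m a≢))
sparse⇒critical {m} (old {a = a} {w = w} a<m r) s inc with ∧-true⁻ {m ≤ᵇ suc a} inc
-- An old letter is at most m, and monotonicity makes it at least m.
... | le , inc′ with ≤-antisym a<m (≤ᵇ⇒≤ m (suc a) (≡⇒T le))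
...   | refl with evenᵇ (suc a) in e
...     | false rewrite kind-≡ {suc a} (is-top e) | ⊔-idem a = sparse⇒critical r s′ inc′
  where
  s′ : Sparse (suc a) w
  s′ b e′ with s b e′
  ... | p , q = ≤-trans (m≤n+m _ _) p , λ b≤m → m+n≡0⇒n≡0 (if b ≡ᵇ suc a then 1 else 0) (q b≤m)
-- An even m would occur again, although sparsity allows it no further occurrence.
...     | true with s (suc a) e
...       | _ , q rewrite ≡ᵇ-refl a with () ← q ≤-refl

module _ {p : ℕ → Bool} where
  conj⁻ : ∀ {w} → foldr (λ a b → p a ∧ b) true w ≡ true → ∀ {a} → a ∈ w → p a ≡ true
  conj⁻ e (here refl) = proj₁ (∧-true⁻ e)
  conj⁻ e (there a∈w) = conj⁻ (proj₂ (∧-true⁻ e)) a∈w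

  conj⁺ : ∀ w → (∀ {a} → a ∈ w → p a ≡ true) → foldr (λ a b → p a ∧ b) true w ≡ true
  conj⁺ []      f = refl
  conj⁺ (a ∷ w) f rewrite f (here refl) = conj⁺ w (f ∘ there)

count⇒∈ : ∀ a w → 1 ≤ countᵇ a w → a ∈ w
count⇒∈ a (b ∷ w) p with a ≟ b
... | yes refl = here refl
... | no a≢b rewrite ≢⇒≡ᵇ a≢b = there (count⇒∈ a w p)

∈⇒count : ∀ {a w} → a ∈ w → 1 ≤ countᵇ a w
∈⇒count {a} (here refl) rewrite ≡ᵇ-refl a = s≤s z≤n
∈⇒count {a} {b ∷ w} (there a∈w) = ≤-trans (∈⇒count a∈w) (m≤n+m _ (if a ≡ᵇ b then 1 else 0))

-- `allowableᵇ` checks only the letters of w, so a positive count is first turned into an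
-- occurrence. The bound a ≤ 0 concerns the letter 0 alone, which no RG-word contains.
allowable⇒sparse : ∀ {k n i w} → RG 0 k n i w → allowableᵇ w ≡ true → Sparse 0 w
allowable⇒sparse {w = w} r al a e = single , none
  where
  single : countᵇ a w ≤ 1
  single with countᵇ a w in ec
  ... | zero  = z≤n
  ... | suc c with conj⁻ {w = w} al (count⇒∈ a w (subst (1 ≤_) (sym ec) (s≤s z≤n)))
  ...   | p rewrite e | ec with c | p
  ...     | zero | _ = ≤-refl

  none : a ≤ 0 → countᵇ a w ≡ 0
  none z≤n with countᵇ 0 w in ec
  ... | zero = refl
  ... | suc _ with All.lookup (RG-letters r) (count⇒∈ 0 w (subst (1 ≤_) (sym ec) (s≤s z≤n)))
  ...   | () , _

sparse⇒allowable : ∀ {m} w → Sparse m w → allowableᵇ w ≡ true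
sparse⇒allowable w s = conj⁺ w λ {a} → go a
  where
  go : ∀ a → a ∈ w → (not (evenᵇ a) ∨ (countᵇ a w ≡ᵇ 1)) ≡ true
  go a a∈w with evenᵇ a in e
  ... | false = refl
  ... | true  = T⇒≡ (≡⇒≡ᵇ _ 1 (≤-antisym (proj₁ (s a e)) (∈⇒count a∈w)))

weaklyInc-tail : ∀ w → weaklyIncᵇ (0 ∷ w) ≡ weaklyIncᵇ w
weaklyInc-tail []      = refl
weaklyInc-tail (a ∷ w) = refl

critical⇔ : ∀ {k n i w} → RG 0 k n i w → criticalᵇ 0 w ≡ allowableᵇ w ∧ weaklyIncᵇ w
critical⇔ {w = w} r = ⇔→≡ (mk⇔ to from)
  where
  to : criticalᵇ 0 w ≡ true → allowableᵇ w ∧ weaklyIncᵇ w ≡ true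
  to c rewrite sparse⇒allowable w (critical⇒sparse r c) =
    trans (sym (weaklyInc-tail w)) (critical⇒weaklyInc r c)

  from : allowableᵇ w ∧ weaklyIncᵇ w ≡ true → criticalᵇ 0 w ≡ true
  from e with ∧-true⁻ e
  ... | al , inc = sparse⇒critical r (allowable⇒sparse r al) (trans (weaklyInc-tail w) inc)

-- Chains

Σℤ-tabulate : ∀ {n} (f : Fin n → ℤ) → Σℤ (tabulate f) ≡ sum f
Σℤ-tabulate {zero}  f = refl
Σℤ-tabulate {suc n} f = cong (f zero +ℤ_) (Σℤ-tabulate (f ∘ suc))

sum-zero : ∀ {n} (f : Fin n → ℤ) → (∀ j → f j ≡ 0ℤ) → sum f ≡ 0ℤ
sum-zero {zero}  f p = refl
sum-zero {suc n} f p = cong₂ _+ℤ_ (p zero) (sum-zero (f ∘ suc) (p ∘ suc))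

-- The linear extension of φ evaluated at the chain c; `δ v` gives the coefficient at v.
pair : (L : List Word) → Coeffs L → (Word → ℤ) → ℤ
pair L c φ = sum (λ j → c j *ℤ φ (lookup L j))

pair-cong : ∀ L c {φ ψ} → (∀ {w} → w ∈ L → φ w ≡ ψ w) → pair L c φ ≡ pair L c ψ
pair-cong L c p = sum-cong-≗ λ j → cong (c j *ℤ_) (p (∈-lookup j))

pair-+ : ∀ L c φ ψ → pair L c (λ w → φ w +ℤ ψ w) ≡ pair L c φ +ℤ pair L c ψ
pair-+ []      c φ ψ = refl
pair-+ (u ∷ L) c φ ψ =
  trans (cong (c zero *ℤ (φ u +ℤ ψ u) +ℤ_) (pair-+ L (c ∘ suc) φ ψ)) (lemma (c zero) (φ u) (ψ u) _ _)
  where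
  lemma : ∀ c x y s t → c *ℤ (x +ℤ y) +ℤ (s +ℤ t) ≡ (c *ℤ x +ℤ s) +ℤ (c *ℤ y +ℤ t)
  lemma = ℤ-Solver.solve-∀

toFun≡pair : ∀ L c v → toFun L c v ≡ pair L c (δ v)
toFun≡pair L c v = trans (Σℤ-tabulate {length L} _) (sum-cong-≗ λ j → scale (lookup L j == v) (c j))
  where
  scale : ∀ t x → (if t then x else 0ℤ) ≡ x *ℤ (if t then 1ℤ else 0ℤ)
  scale true  x = sym (ℤₚ.*-identityʳ x)
  scale false x = sym (ℤₚ.*-zeroʳ x)

==-refl : ∀ w → (w == w) ≡ true
==-refl w = dec-true (≡-dec _≟_ w w) refl

≢⇒== : ∀ {u v} → u ≢ v → (u == v) ≡ false
≢⇒== {u} {v} = dec-false (≡-dec _≟_ u v)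

δ-sym : ∀ u v → δ u v ≡ δ v u
δ-sym u v with ≡-dec _≟_ v u
... | yes refl rewrite ==-refl u = refl
... | no v≢u rewrite ≢⇒== (v≢u ∘ sym) = refl

-- The coefficient at a critical word can be read off after π. With `D-P` it vanishes on boundaries.
δ-critical : ∀ m v → criticalᵇ m v ≡ true → ∀ u → δ v u ≡ P m u (δ v)
δ-critical m v c u with ≡-dec _≟_ u v
... | yes refl rewrite c = refl
... | no u≢v with criticalᵇ m u
...   | true  = refl
...   | false = refl

pair-lookup : ∀ {L} → Unique L → ∀ c j → pair L c (δ (lookup L j)) ≡ c j
pair-lookup {u ∷ L} (u∉L ∷ _) c zero rewrite ==-refl u =
  trans (cong₂ _+ℤ_ (ℤₚ.*-identityʳ (c zero)) (sum-zero _ vanish)) (ℤₚ.+-identityʳ (c zero))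
  where
  vanish : ∀ j → c (suc j) *ℤ δ u (lookup L j) ≡ 0ℤ
  vanish j rewrite ≢⇒== (All.lookup u∉L (∈-lookup j) ∘ sym) = ℤₚ.*-zeroʳ (c (suc j))
pair-lookup {u ∷ L} (u∉L ∷ uniq) c (suc j) rewrite ≢⇒== (All.lookup u∉L (∈-lookup j)) =
  trans (cong₂ _+ℤ_ (ℤₚ.*-zeroʳ (c zero)) (pair-lookup uniq (c ∘ suc) j)) (ℤₚ.+-identityˡ (c (suc j)))

δ-expansion : ∀ {L} → Unique L → ∀ ψ {x} → x ∈ L → ψ x ≡ sum (λ j → ψ (lookup L j) *ℤ δ (lookup L j) x)
δ-expansion {L} uniq ψ {x} x∈L with index x∈L | lookup-index x∈L
... | j | refl = sym (trans (sum-cong-≗ λ l → cong (ψ (lookup L l) *ℤ_) (δ-sym (lookup L l) x))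
                            (pair-lookup uniq (ψ ∘ lookup L) j))

record Linear (F : (Word → ℤ) → ℤ) : Set where
  field
    zeroᴸ : F (λ _ → 0ℤ) ≡ 0ℤ
    addᴸ  : ∀ c φ ψ → F (λ u → c *ℤ φ u +ℤ ψ u) ≡ c *ℤ F φ +ℤ F ψ

  sumᴸ : ∀ {n} (g : Fin n → ℤ) (f : Fin n → Word → ℤ) →
         F (λ u → sum (λ j → g j *ℤ f j u)) ≡ sum (λ j → g j *ℤ F (f j))
  sumᴸ {zero}  g f = zeroᴸ
  sumᴸ {suc n} g f =
    trans (addᴸ (g zero) (f zero) _) (cong (g zero *ℤ F (f zero) +ℤ_) (sumᴸ (g ∘ suc) (f ∘ suc)))

open Linear

zero-addᴸ : ∀ c → 0ℤ ≡ c *ℤ 0ℤ +ℤ 0ℤ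
zero-addᴸ = ℤ-Solver.solve-∀

D-linear : ∀ m w → Linear (D m w)
D-linear m w = record { zeroᴸ = D-zero m w ; addᴸ = λ c → go m w c }
  where
  lemma : ∀ c x y s t → c *ℤ x +ℤ y -ℤ (c *ℤ s +ℤ t) ≡ c *ℤ (x -ℤ s) +ℤ (y -ℤ t)
  lemma = ℤ-Solver.solve-∀

  go : ∀ m w c φ ψ → D m w (λ u → c *ℤ φ u +ℤ ψ u) ≡ c *ℤ D m w φ +ℤ D m w ψ
  go m []      c φ ψ = zero-addᴸ c
  go m (a ∷ w) c φ ψ with kind m a
  ... | critical = go (m ⊔ a) w c (φ ∘ (a ∷_)) (ψ ∘ (a ∷_))
  ... | low      = go (m ⊔ a) w c (φ ∘ (a ∷_)) (ψ ∘ (a ∷_))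
  ... | repeated = trans (cong (c *ℤ φ ((a ∸ 1) ∷ w) +ℤ ψ ((a ∸ 1) ∷ w) -ℤ_)
                           (go (m ⊔ a) w c (φ ∘ (a ∷_)) (ψ ∘ (a ∷_))))
                         (lemma c (φ ((a ∸ 1) ∷ w)) _ _ _)

H-linear : ∀ m w → Linear (H m w)
H-linear m []      = record { zeroᴸ = refl ; addᴸ = λ c _ _ → zero-addᴸ c }
H-linear m (a ∷ w) with kind m a
... | critical = record { zeroᴸ = zeroᴸ ih ; addᴸ = λ c φ ψ → addᴸ ih c (φ ∘ (a ∷_)) (ψ ∘ (a ∷_)) }
  where ih = H-linear (m ⊔ a) w
... | low      = record { zeroᴸ = refl ; addᴸ = λ _ _ _ → refl }
... | repeated = record { zeroᴸ = refl ; addᴸ = λ c _ _ → zero-addᴸ c }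

P-linear : ∀ m w → Linear (P m w)
P-linear m w with criticalᵇ m w
... | true  = record { zeroᴸ = refl ; addᴸ = λ _ _ _ → refl }
... | false = record { zeroᴸ = refl ; addᴸ = λ c _ _ → zero-addᴸ c }

-- Turns an operator on functionals (`D`, `H` or `P`) back into chains. If `F w` sees only values on
-- L, expand ψ in the indicators of L and exchange the sums: F applied to z is the chain on L whose
-- coefficients come from testing against these indicators.
pair-expansion : ∀ {L} M → Unique L → (z : Coeffs M) (F : Word → (Word → ℤ) → ℤ) → (∀ w → Linear (F w)) →
                 (∀ {w φ ψ} → w ∈ M → (∀ {u} → u ∈ L → φ u ≡ ψ u) → F w φ ≡ F w ψ) →
                 ∀ ψ → pair M z (λ w → F w ψ) ≡ pair L (λ j → pair M z (λ w → F w (δ (lookup L j)))) ψ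
pair-expansion {L} M uniq z F linear local ψ = begin
  sum (λ i → z i *ℤ F (lookup M i) ψ)
    ≡⟨ sum-cong-≗ (λ i → cong (z i *ℤ_) (trans (local (∈-lookup i) (δ-expansion uniq ψ))
                                                (sumᴸ (linear (lookup M i)) (ψ ∘ lookup L) (λ j → δ (lookup L j))))) ⟩
  sum (λ i → z i *ℤ sum (λ j → ψ (lookup L j) *ℤ G j i))
    ≡⟨ sum-cong-≗ (λ i → *-distribˡ-sum (z i) (λ j → ψ (lookup L j) *ℤ G j i)) ⟩
  sum (λ i → sum (λ j → z i *ℤ (ψ (lookup L j) *ℤ G j i)))
    ≡⟨ ∑-comm (λ i j → z i *ℤ (ψ (lookup L j) *ℤ G j i)) ⟩
  sum (λ j → sum (λ i → z i *ℤ (ψ (lookup L j) *ℤ G j i)))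
    ≡⟨ sum-cong-≗ (λ j → sum-cong-≗ λ i → lemma (z i) (ψ (lookup L j)) (G j i)) ⟩
  sum (λ j → sum (λ i → ψ (lookup L j) *ℤ (z i *ℤ G j i)))
    ≡⟨ sum-cong-≗ (λ j → *-distribˡ-sum (ψ (lookup L j)) (λ i → z i *ℤ G j i)) ⟨
  sum (λ j → ψ (lookup L j) *ℤ sum (λ i → z i *ℤ G j i))
    ≡⟨ sum-cong-≗ (λ j → ℤₚ.*-comm (ψ (lookup L j)) _) ⟩
  sum (λ j → sum (λ i → z i *ℤ G j i) *ℤ ψ (lookup L j)) ∎
  where
  open ≡-Reasoning
  G : Fin (length L) → Fin (length M) → ℤ
  G j i = F (lookup M i) (δ (lookup L j))

  lemma : ∀ x y z → x *ℤ (y *ℤ z) ≡ y *ℤ (x *ℤ z)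
  lemma = ℤ-Solver.solve-∀

-- Enumeration of the basis words

concatMap-map : ∀ {A B C : Set} (f : A → B → C) xs ys →
                concatMap (λ x → map (f x) ys) xs ≡ cartesianProductWith f xs ys
concatMap-map f []       ys = refl
concatMap-map f (x ∷ xs) ys = cong (map (f x) ys ++_) (concatMap-map f xs ys)

wordsOver-suc : ∀ m n → wordsOver m (suc n) ≡ cartesianProductWith _∷_ (applyUpTo suc m) (wordsOver m n)
wordsOver-suc m n = concatMap-map _∷_ (applyUpTo suc m) (wordsOver m n)

wordsOver-unique : ∀ m n → Unique (wordsOver m n)
wordsOver-unique m zero    = [] ∷ []
wordsOver-unique m (suc n) rewrite wordsOver-suc m n =
  Unique.cartesianProductWith⁺ _∷_ ∷-injective
    (Unique.applyUpTo⁺₁ suc m (λ i<j _ → <⇒≢ i<j ∘ suc-injective)) (wordsOver-unique m n)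

wordsOver-length : ∀ m n {w} → w ∈ wordsOver m n → length w ≡ n
wordsOver-length m zero    (here refl) = refl
wordsOver-length m (suc n) w∈ rewrite wordsOver-suc m n
  with ∈-cartesianProductWith⁻ _∷_ (applyUpTo suc m) (wordsOver m n) w∈
... | _ , _ , _ , u∈ , refl = cong suc (wordsOver-length m n u∈)

∈-wordsOver : ∀ m {w} → All (λ a → 1 ≤ a × a ≤ m) w → w ∈ wordsOver m (length w)
∈-wordsOver m []                                   = here refl
∈-wordsOver m {suc a ∷ w} ((_ , a<m) ∷ qs) rewrite wordsOver-suc m (length w) =
  ∈-cartesianProductWith⁺ _∷_ (∈-applyUpTo⁺ suc a<m) (∈-wordsOver m qs)

∈-select⁺ : ∀ {p L w} → w ∈ L → p w ≡ true → w ∈ select p L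
∈-select⁺ {p} = ∈-filter⁺ (λ w → p w ≟B true)

∈-select⁻ : ∀ {p L w} → w ∈ select p L → w ∈ L × p w ≡ true
∈-select⁻ {p} = ∈-filter⁻ (λ w → p w ≟B true)

select-unique : ∀ p {L} → Unique L → Unique (select p L)
select-unique p = Unique.filter⁺ (λ w → p w ≟B true)

B-unique : ∀ n k i → Unique (B n k i)
B-unique n k i = select-unique _ (select-unique _ (wordsOver-unique n n))

W-unique : ∀ n k i → Unique (W n k i)
W-unique n k i = select-unique _ (B-unique n k i)

∈B⇒RG : ∀ n k i {w} → w ∈ B n k i → RG 0 k n i w
∈B⇒RG n k i {w} w∈B with ∈-select⁻ w∈B
... | w∈R , rank≡i with ∈-select⁻ w∈R
...   | w∈words , rg∧max with ∧-true⁻ {isRG w} rg∧max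
...     | rg , max≡k with rgFrom-RG 0 w rg
...       | i′ , r with wordsOver-length n n w∈words | ≡ᵇ⇒≡ (maxLetter w) k (≡⇒T max≡k)
...         | refl | refl = subst (λ i → RG 0 k n i w) (trans (sym (RG-rank r)) (≡ᵇ⇒≡ _ i (≡⇒T rank≡i))) r

RG⇒∈B : ∀ {k n i w} → RG 0 k n i w → w ∈ B n k i
RG⇒∈B {k} {n} {i} {w} r = ∈-select⁺ (∈-select⁺ w∈words rg∧max) (T⇒≡ (≡⇒≡ᵇ _ i (RG-rank r)))
  where
  w∈words : w ∈ wordsOver n n
  w∈words = subst (λ l → w ∈ wordsOver n l) (RG-length r) (∈-wordsOver n (RG-letters r))

  rg∧max : isRG w ∧ (maxLetter w ≡ᵇ k) ≡ true
  rg∧max rewrite RG-rgFrom r = T⇒≡ (≡⇒≡ᵇ _ k (RG-maxLetter r))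

∈W⇒critical : ∀ n k i {w} → w ∈ W n k i → RG 0 k n i w × criticalᵇ 0 w ≡ true
∈W⇒critical n k i w∈W with ∈-select⁻ w∈W
... | w∈B , e = ∈B⇒RG n k i w∈B , trans (critical⇔ (∈B⇒RG n k i w∈B)) e

critical⇒∈W : ∀ {n k i w} → RG 0 k n i w → criticalᵇ 0 w ≡ true → w ∈ W n k i
critical⇒∈W r c = ∈-select⁺ (RG⇒∈B r) (trans (sym (critical⇔ r)) c)

-- Cycles, boundaries and the basis of homology

∂chain≡pair : ∀ n k i b v → ∂chain (B n k i) b v ≡ pair (B n k i) b (λ w → D 0 w (δ v))
∂chain≡pair n k i b v = trans (Σℤ-tabulate {length (B n k i)} _)
  (sum-cong-≗ λ j → cong (b j *ℤ_) (coeffIn-∂word (∈B⇒RG n k i (∈-lookup j)) v))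

critical-cycle : ∀ n k i (j : Fin (length (W n k i))) v → coeffIn v (∂word (lookup (W n k i) j)) ≡ 0ℤ
critical-cycle n k i j v = trans (coeffIn-∂word (proj₁ w∈W) v) (critical-D 0 (lookup (W n k i) j) (δ v) (proj₂ w∈W))
  where w∈W = ∈W⇒critical n k i (∈-lookup j)

module _ (n k i : ℕ) (z : Coeffs (B n k i)) where
  -- The coordinates of π(z); those of h(z) follow as `bounding`.
  retract : Coeffs (W n k i)
  retract j = pair (B n k i) z (λ w → P 0 w (δ (lookup (W n k i) j)))

  bounding : Coeffs (B n k (suc i))
  bounding j = pair (B n k i) z (λ w → H 0 w (δ (lookup (B n k (suc i)) j)))

  pair-retract : ∀ ψ → pair (B n k i) z (λ w → P 0 w ψ) ≡ pair (W n k i) retract ψ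
  pair-retract = pair-expansion (B n k i) (W-unique n k i) z (P 0) (P-linear 0) local
    where
    local : ∀ {w φ ψ} → w ∈ B n k i → (∀ {u} → u ∈ W n k i → φ u ≡ ψ u) → P 0 w φ ≡ P 0 w ψ
    local {w} w∈B p with criticalᵇ 0 w in c
    ... | true  = p (critical⇒∈W (∈B⇒RG n k i w∈B) c)
    ... | false = refl

  pair-bounding : ∀ ψ → pair (B n k i) z (λ w → H 0 w ψ) ≡ pair (B n k (suc i)) bounding ψ
  pair-bounding = pair-expansion (B n k i) (B-unique n k (suc i)) z (H 0) (H-linear 0)
    λ w∈B p → H-local (∈B⇒RG n k i w∈B) (λ u r → p (RG⇒∈B r))

  -- `IsCycle` tests ∂z only against indicators, while the homotopy formula needs it against `H`.
  -- All terms of ∂z lie in `wordsOver n n`, so indicators suffice; as this list is independent of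
  -- the rank, i = 0 is no special case.
  cycle-D : IsCycle n k i z → ∀ ψ → pair (B n k i) z (λ w → D 0 w ψ) ≡ 0ℤ
  cycle-D cycle ψ = trans
    (pair-expansion (B n k i) (wordsOver-unique n n) z (D 0) (D-linear 0) local ψ)
    (sum-zero _ λ j → cong (_*ℤ ψ (lookup (wordsOver n n) j))
                        (trans (sym (∂chain≡pair n k i z (lookup (wordsOver n n) j))) (cycle _)))
    where
    -- A repeated letter is even, so its predecessor is odd and therefore still positive.
    Q-pred : ∀ {m a} → kind m a ≡ repeated → 1 ≤ a × a ≤ n → 1 ≤ a ∸ 1 × a ∸ 1 ≤ n
    Q-pred {a = suc a} e (_ , a<n) with kind-view (repeated-pred e)
    ... | is-low odd _ = positive a odd , <⇒≤ a<n
      where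
      positive : ∀ a → evenᵇ a ≡ false → 1 ≤ a
      positive (suc a) _ = s≤s z≤n

    local : ∀ {w φ ψ} → w ∈ B n k i → (∀ {u} → u ∈ wordsOver n n → φ u ≡ ψ u) → D 0 w φ ≡ D 0 w ψ
    local w∈B p = D-local Q-pred 0 (RG-letters r) λ u l qs →
      p (subst (λ l → u ∈ wordsOver n l) (trans l (RG-length r)) (∈-wordsOver n qs))
      where r = ∈B⇒RG n k i w∈B

  -- Summing the homotopy over z gives z - π(z) = h∂(z) + ∂h(z). The first term vanishes for a
  -- cycle, so h(z) bounds the difference.
  cycle-homologous : IsCycle n k i z → Homologous n k i (toFun (B n k i) z) (toFun (W n k i) retract)
  cycle-homologous cycle = bounding , λ v → begin
    toFun (B n k i) z v -ℤ toFun (W n k i) retract v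
      ≡⟨ cong₂ _-ℤ_ (toFun≡pair (B n k i) z v) (toFun≡pair (W n k i) retract v) ⟩
    ⟨z, δ v ⟩ -ℤ pair (W n k i) retract (δ v)
      ≡⟨ cong (⟨z, δ v ⟩ -ℤ_) (pair-retract (δ v)) ⟨
    ⟨z, δ v ⟩ -ℤ ⟨z, P′ v ⟩
      ≡⟨ cong (_-ℤ ⟨z, P′ v ⟩) (begin
        ⟨z, δ v ⟩
          ≡⟨ pair-cong (B n k i) z (λ {w} w∈B → split v {w} (∈B⇒RG n k i w∈B)) ⟩
        ⟨z, (λ w → P′ v w +ℤ (DH v w +ℤ HD v w)) ⟩
          ≡⟨ pair-+ (B n k i) z (P′ v) (λ w → DH v w +ℤ HD v w) ⟩
        ⟨z, P′ v ⟩ +ℤ ⟨z, (λ w → DH v w +ℤ HD v w) ⟩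
          ≡⟨ cong (⟨z, P′ v ⟩ +ℤ_) (pair-+ (B n k i) z (DH v) (HD v)) ⟩
        ⟨z, P′ v ⟩ +ℤ (⟨z, DH v ⟩ +ℤ ⟨z, HD v ⟩) ∎) ⟩
    ⟨z, P′ v ⟩ +ℤ (⟨z, DH v ⟩ +ℤ ⟨z, HD v ⟩) -ℤ ⟨z, P′ v ⟩
      ≡⟨ cancel ⟨z, P′ v ⟩ (⟨z, DH v ⟩ +ℤ ⟨z, HD v ⟩) ⟩
    ⟨z, DH v ⟩ +ℤ ⟨z, HD v ⟩
      ≡⟨ cong₂ _+ℤ_ (cycle-D cycle (λ u → H 0 u (δ v))) (pair-bounding (λ u → D 0 u (δ v))) ⟩
    0ℤ +ℤ pair (B n k (suc i)) bounding (λ u → D 0 u (δ v))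
      ≡⟨ ℤₚ.+-identityˡ _ ⟩
    pair (B n k (suc i)) bounding (λ u → D 0 u (δ v))
      ≡⟨ ∂chain≡pair n k (suc i) bounding v ⟨
    ∂chain (B n k (suc i)) bounding v ∎
    where
    open ≡-Reasoning
    ⟨z,_⟩ : (Word → ℤ) → ℤ
    ⟨z, φ ⟩ = pair (B n k i) z φ

    P′ DH HD : Word → Word → ℤ
    P′ v w = P 0 w (δ v)
    DH v w = D 0 w (λ u → H 0 u (δ v))
    HD v w = H 0 w (λ u → D 0 u (δ v))

    cancel : ∀ x y → x +ℤ y -ℤ x ≡ y
    cancel = ℤ-Solver.solve-∀

    regroup : ∀ x y → x ≡ y +ℤ (x -ℤ y)
    regroup = ℤ-Solver.solve-∀

    split : ∀ v {w} → RG 0 k n i w → δ v w ≡ P′ v w +ℤ (DH v w +ℤ HD v w)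
    split v {w} r = trans (regroup (δ v w) (P′ v w))
      (cong (P′ v w +ℤ_) (homotopy 0 (All.map proj₁ (RG-letters r)) (δ v)))

  -- Boundaries vanish at critical words, so homologous chains agree there. This determines c.
  homologous-coefficient : ∀ c → Homologous n k i (toFun (B n k i) z) (toFun (W n k i) c) →
                           ∀ j → c j ≡ toFun (B n k i) z (lookup (W n k i) j)
  homologous-coefficient c (b , eq) j = begin
    c j                     ≡⟨ pair-lookup (W-unique n k i) c j ⟨
    pair (W n k i) c (δ v)  ≡⟨ toFun≡pair (W n k i) c v ⟨
    toFun (W n k i) c v     ≡⟨ ℤₚ.i-j≡0⇒i≡j (toFun (B n k i) z v) (toFun (W n k i) c v) (trans (eq v) no-boundary) ⟨
    toFun (B n k i) z v     ∎
    where
    open ≡-Reasoning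
    v = lookup (W n k i) j

    v-critical : criticalᵇ 0 v ≡ true
    v-critical = proj₂ (∈W⇒critical n k i (∈-lookup j))

    no-boundary : ∂chain (B n k (suc i)) b v ≡ 0ℤ
    no-boundary = trans (∂chain≡pair n k (suc i) b v) (sum-zero _ λ l →
      trans (cong (b l *ℤ_) (trans (D-cong 0 (lookup (B n k (suc i)) l) (δ-critical 0 v v-critical))
                                   (D-P 0 (lookup (B n k (suc i)) l) (δ v))))
            (ℤₚ.*-zeroʳ (b l)))

-- Polynomials and Gaussian binomials

infixl 6 _⊕_
infixl 7 _⋆_

_⊕_ : Poly → Poly → Poly
(f ⊕ g) i = f i + g i

-- The Cauchy product, recursive in the first factor so that its laws follow by induction on the
-- index; `⊛≗⋆` links it to the product of the statement.
_⋆_ : Poly → Poly → Poly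
(f ⋆ g) zero    = f 0 * g 0
(f ⋆ g) (suc i) = f 0 * g (suc i) + ((f ∘ suc) ⋆ g) i

-- Multiplication by the c-th power of the variable.
shift : ℕ → Poly → Poly
shift zero    f i       = f i
shift (suc c) f zero    = 0
shift (suc c) f (suc i) = shift c f i

⊛≗⋆ : ∀ f g → f ⊛ g ≗ f ⋆ g
⊛≗⋆ f g i = trans (cong sumℕ (map-upTo (λ j → f j * g (i ∸ j)) (suc i))) (go f i)
  where
  go : ∀ f i → sumℕ (applyUpTo (λ j → f j * g (i ∸ j)) (suc i)) ≡ (f ⋆ g) i
  go f zero    = +-identityʳ _
  go f (suc i) = cong (f 0 * g (suc i) +_) (go (f ∘ suc) i)

⋆-cong : ∀ {f f′ g g′} → f ≗ f′ → g ≗ g′ → f ⋆ g ≗ f′ ⋆ g′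
⋆-cong p q zero    = cong₂ _*_ (p 0) (q 0)
⋆-cong p q (suc i) = cong₂ _+_ (cong₂ _*_ (p 0) (q (suc i))) (⋆-cong (p ∘ suc) q i)

⋆-congˡ : ∀ f {g g′} → g ≗ g′ → f ⋆ g ≗ f ⋆ g′
⋆-congˡ f = ⋆-cong {f} (λ _ → refl)

⋆-congʳ : ∀ g {f f′} → f ≗ f′ → f ⋆ g ≗ f′ ⋆ g
⋆-congʳ g p = ⋆-cong {g = g} p (λ _ → refl)

-- The definition peels off the lowest coefficient of f; peeling off that of g gives the mirrored
-- recursion that commutativity needs.
⋆-suc : ∀ f g i → (f ⋆ g) (suc i) ≡ f (suc i) * g 0 + (f ⋆ (g ∘ suc)) i
⋆-suc f g zero    = +-comm (f 0 * g 1) (f 1 * g 0)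
⋆-suc f g (suc i) = begin
  f 0 * g (2 + i) + ((f ∘ suc) ⋆ g) (suc i)
    ≡⟨ cong (f 0 * g (2 + i) +_) (⋆-suc (f ∘ suc) g i) ⟩
  f 0 * g (2 + i) + (f (2 + i) * g 0 + ((f ∘ suc) ⋆ (g ∘ suc)) i)
    ≡⟨ x∙yz≈y∙xz (f 0 * g (2 + i)) (f (2 + i) * g 0) _ ⟩
  f (2 + i) * g 0 + (f ⋆ (g ∘ suc)) (suc i) ∎
  where open ≡-Reasoning

⋆-comm : ∀ f g → f ⋆ g ≗ g ⋆ f
⋆-comm f g zero    = *-comm (f 0) (g 0)
⋆-comm f g (suc i) = begin
  f 0 * g (suc i) + ((f ∘ suc) ⋆ g) i  ≡⟨ cong₂ _+_ (*-comm (f 0) (g (suc i))) (⋆-comm (f ∘ suc) g i) ⟩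
  g (suc i) * f 0 + (g ⋆ (f ∘ suc)) i  ≡⟨ ⋆-suc g f i ⟨
  (g ⋆ f) (suc i)                      ∎
  where open ≡-Reasoning

⋆-distribʳ-⊕ : ∀ h f g → (f ⊕ g) ⋆ h ≗ f ⋆ h ⊕ g ⋆ h
⋆-distribʳ-⊕ h f g zero    = *-distribʳ-+ (h 0) (f 0) (g 0)
⋆-distribʳ-⊕ h f g (suc i) = begin
  (f 0 + g 0) * h (suc i) + ((f ∘ suc ⊕ g ∘ suc) ⋆ h) i
    ≡⟨ cong₂ _+_ (*-distribʳ-+ (h (suc i)) (f 0) (g 0)) (⋆-distribʳ-⊕ h (f ∘ suc) (g ∘ suc) i) ⟩
  (f 0 * h (suc i) + g 0 * h (suc i)) + (((f ∘ suc) ⋆ h) i + ((g ∘ suc) ⋆ h) i)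
    ≡⟨ interchange (f 0 * h (suc i)) _ _ _ ⟩
  (f ⋆ h) (suc i) + (g ⋆ h) (suc i) ∎
  where open ≡-Reasoning

⋆-distribˡ-⊕ : ∀ f g h → f ⋆ (g ⊕ h) ≗ f ⋆ g ⊕ f ⋆ h
⋆-distribˡ-⊕ f g h i = begin
  (f ⋆ (g ⊕ h)) i        ≡⟨ ⋆-comm f (g ⊕ h) i ⟩
  ((g ⊕ h) ⋆ f) i        ≡⟨ ⋆-distribʳ-⊕ f g h i ⟩
  (g ⋆ f) i + (h ⋆ f) i  ≡⟨ cong₂ _+_ (⋆-comm g f i) (⋆-comm h f i) ⟩
  (f ⋆ g) i + (f ⋆ h) i  ∎
  where open ≡-Reasoning

⋆-scale : ∀ c f g → (λ j → c * f j) ⋆ g ≗ (λ j → c * (f ⋆ g) j)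
⋆-scale c f g zero    = *-assoc c (f 0) (g 0)
⋆-scale c f g (suc i) = begin
  c * f 0 * g (suc i) + ((λ j → c * f (suc j)) ⋆ g) i  ≡⟨ cong₂ _+_ (*-assoc c (f 0) _) (⋆-scale c (f ∘ suc) g i) ⟩
  c * (f 0 * g (suc i)) + c * ((f ∘ suc) ⋆ g) i        ≡⟨ *-distribˡ-+ c _ _ ⟨
  c * (f ⋆ g) (suc i)                                  ∎
  where open ≡-Reasoning

⋆-assoc : ∀ f g h → (f ⋆ g) ⋆ h ≗ f ⋆ (g ⋆ h)
⋆-assoc f g h zero    = *-assoc (f 0) (g 0) (h 0)
⋆-assoc f g h (suc i) = begin
  -- Without its lowest coefficient, `f ⋆ g` is by definition the sum displayed as left factor here.
  f 0 * g 0 * h (suc i) + (((λ j → f 0 * g (suc j)) ⊕ (f ∘ suc) ⋆ g) ⋆ h) i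
    ≡⟨ cong₂ _+_ (*-assoc (f 0) (g 0) _) (⋆-distribʳ-⊕ h (λ j → f 0 * g (suc j)) ((f ∘ suc) ⋆ g) i) ⟩
  f 0 * (g 0 * h (suc i)) + (((λ j → f 0 * g (suc j)) ⋆ h) i + (((f ∘ suc) ⋆ g) ⋆ h) i)
    ≡⟨ cong (f 0 * (g 0 * h (suc i)) +_) (cong₂ _+_ (⋆-scale (f 0) (g ∘ suc) h i) (⋆-assoc (f ∘ suc) g h i)) ⟩
  f 0 * (g 0 * h (suc i)) + (f 0 * ((g ∘ suc) ⋆ h) i + ((f ∘ suc) ⋆ (g ⋆ h)) i)
    ≡⟨ +-assoc (f 0 * (g 0 * h (suc i))) _ _ ⟨
  f 0 * (g 0 * h (suc i)) + f 0 * ((g ∘ suc) ⋆ h) i + ((f ∘ suc) ⋆ (g ⋆ h)) i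
    ≡⟨ cong (_+ ((f ∘ suc) ⋆ (g ⋆ h)) i) (*-distribˡ-+ (f 0) _ _) ⟨
  (f ⋆ (g ⋆ h)) (suc i) ∎
  where open ≡-Reasoning

⋆-zeroˡ : ∀ g → (λ _ → 0) ⋆ g ≗ (λ _ → 0)
⋆-zeroˡ g zero    = refl
⋆-zeroˡ g (suc i) = ⋆-zeroˡ g i

⋆-identityˡ : ∀ f → onePoly ⋆ f ≗ f
⋆-identityˡ f zero    = +-identityʳ (f 0)
⋆-identityˡ f (suc i) = begin
  f (suc i) + 0 + ((λ _ → 0) ⋆ f) i  ≡⟨ cong₂ _+_ (+-identityʳ (f (suc i))) (⋆-zeroˡ f i) ⟩
  f (suc i) + 0                      ≡⟨ +-identityʳ (f (suc i)) ⟩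
  f (suc i)                          ∎
  where open ≡-Reasoning

⋆-identityʳ : ∀ f → f ⋆ onePoly ≗ f
⋆-identityʳ f i = trans (⋆-comm f onePoly i) (⋆-identityˡ f i)

shift-cong : ∀ c {f g} → f ≗ g → shift c f ≗ shift c g
shift-cong zero    p i       = p i
shift-cong (suc c) p zero    = refl
shift-cong (suc c) p (suc i) = shift-cong c p i

shift-shift : ∀ c d f → shift (c + d) f ≗ shift c (shift d f)
shift-shift zero    d f i       = refl
shift-shift (suc c) d f zero    = refl
shift-shift (suc c) d f (suc i) = shift-shift c d f i

shift-⊕ : ∀ c f g → shift c (f ⊕ g) ≗ shift c f ⊕ shift c g
shift-⊕ zero    f g i       = refl
shift-⊕ (suc c) f g zero    = refl
shift-⊕ (suc c) f g (suc i) = shift-⊕ c f g i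

shift-⋆ : ∀ c f g → shift c f ⋆ g ≗ shift c (f ⋆ g)
shift-⋆ zero    f g i       = refl
shift-⋆ (suc c) f g zero    = refl
shift-⋆ (suc c) f g (suc i) = shift-⋆ c f g i

⋆-shift : ∀ c f g → f ⋆ shift c g ≗ shift c (f ⋆ g)
⋆-shift c f g i = begin
  (f ⋆ shift c g) i  ≡⟨ ⋆-comm f (shift c g) i ⟩
  (shift c g ⋆ f) i  ≡⟨ shift-⋆ c g f i ⟩
  shift c (g ⋆ f) i  ≡⟨ shift-cong c (⋆-comm g f) i ⟩
  shift c (f ⋆ g) i  ∎
  where open ≡-Reasoning

-- Dropping one coefficient before the substitution x = q² drops two after it, hence the inductions
-- in steps of two below.
sq-suc : ∀ f i → sq f (2 + i) ≡ sq (f ∘ suc) i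
sq-suc f i = cong (λ j → if evenᵇ i then f j else 0) (+-distrib-/-∣ˡ {2} i (divides 1 refl))

sq-cong : ∀ {f g} → f ≗ g → sq f ≗ sq g
sq-cong p i = cong (λ y → if evenᵇ i then y else 0) (p (i / 2))

sq-⊕ : ∀ f g → sq (f ⊕ g) ≗ sq f ⊕ sq g
sq-⊕ f g i with evenᵇ i
... | true  = refl
... | false = refl

sq-scale : ∀ c f → sq (λ j → c * f j) ≗ (λ i → c * sq f i)
sq-scale c f i with evenᵇ i
... | true  = refl
... | false = sym (*-zeroʳ c)

sq-shift : ∀ c f → sq (shift c f) ≗ shift (c * 2) (sq f)
sq-shift zero    f i             = refl
sq-shift (suc c) f zero          = refl
sq-shift (suc c) f (suc zero)    = refl
sq-shift (suc c) f (suc (suc i)) = trans (sq-suc (shift (suc c) f) i) (sq-shift c f i)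

sq-onePoly : sq onePoly ≗ onePoly
sq-onePoly zero          = refl
sq-onePoly (suc zero)    = refl
sq-onePoly (suc (suc i)) = trans (sq-suc onePoly i) (zeros i)
  where
  zeros : sq (λ _ → 0) ≗ (λ _ → 0)
  zeros i with evenᵇ i
  ... | true  = refl
  ... | false = refl

sq-⋆ : ∀ f g → sq (f ⋆ g) ≗ sq f ⋆ sq g
sq-⋆ f g zero          = refl
sq-⋆ f g (suc zero)    = sym (trans (+-identityʳ _) (*-zeroʳ (f 0)))
sq-⋆ f g (suc (suc i)) = begin
  sq (f ⋆ g) (2 + i)
    ≡⟨ sq-suc (f ⋆ g) i ⟩
  sq ((λ j → f 0 * g (suc j)) ⊕ (f ∘ suc) ⋆ g) i
    ≡⟨ sq-⊕ (λ j → f 0 * g (suc j)) ((f ∘ suc) ⋆ g) i ⟩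
  sq (λ j → f 0 * g (suc j)) i + sq ((f ∘ suc) ⋆ g) i
    ≡⟨ cong₂ _+_ (sq-scale (f 0) (g ∘ suc) i) (sq-⋆ (f ∘ suc) g i) ⟩
  f 0 * sq (g ∘ suc) i + (sq (f ∘ suc) ⋆ sq g) i
    ≡⟨ cong₂ _+_ (cong (f 0 *_) (sq-suc g i)) (⋆-congʳ (sq g) (sq-suc f) i) ⟨
  -- The term with the factor `sq f 1` is 0 by computation.
  f 0 * sq g (2 + i) + ((λ j → sq f (2 + j)) ⋆ sq g) i ∎
  where open ≡-Reasoning

gauss : ℕ → ℕ → Poly
gauss zero    N       = onePoly
gauss (suc s) zero    = onePoly
gauss (suc s) (suc N) = shift (suc N) (gauss s (suc N)) ⊕ gauss (suc s) N

qInt-+ : ∀ a b → qInt (a + b) ≗ qInt a ⊕ shift a (qInt b)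
qInt-+ zero    b j       = refl
qInt-+ (suc a) b zero    = refl
qInt-+ (suc a) b (suc j) = qInt-+ a b j

qFact-suc : ∀ m → qFact (suc m) ≗ qFact m ⋆ qInt (suc m)
qFact-suc m = ⊛≗⋆ (qFact m) (qInt (suc m))

-- Characterises the quotient of factorials without division. After multiplication by the
-- factorials, Pascal's recursion becomes [N + s + 2] = [N + 1] + x^(N + 1) [s + 1].
gauss-qFact : ∀ s N → gauss s N ⋆ (qFact s ⋆ qFact N) ≗ qFact (N + s)
gauss-qFact zero N i = begin
  (onePoly ⋆ (onePoly ⋆ qFact N)) i  ≡⟨ ⋆-identityˡ (onePoly ⋆ qFact N) i ⟩
  (onePoly ⋆ qFact N) i              ≡⟨ ⋆-identityˡ (qFact N) i ⟩
  qFact N i                          ≡⟨ cong (λ a → qFact a i) (+-identityʳ N) ⟨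
  qFact (N + 0) i                    ∎
  where open ≡-Reasoning
gauss-qFact (suc s) zero i =
  trans (⋆-identityˡ (qFact (suc s) ⋆ onePoly) i) (⋆-identityʳ (qFact (suc s)) i)
gauss-qFact (suc s) (suc N) = begin
  (shift (suc N) G ⊕ G′) ⋆ (S′ ⋆ N′)                    ≈⟨ ⋆-distribʳ-⊕ (S′ ⋆ N′) (shift (suc N) G) G′ ⟩
  shift (suc N) G ⋆ (S′ ⋆ N′) ⊕ G′ ⋆ (S′ ⋆ N′)          ≈⟨ (λ i → cong₂ _+_ (left i) (right i)) ⟩
  M ⋆ shift (suc N) (qInt (suc s)) ⊕ M ⋆ qInt (suc N)   ≈⟨ ⋆-distribˡ-⊕ M (shift (suc N) (qInt (suc s))) (qInt (suc N)) ⟨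
  M ⋆ (shift (suc N) (qInt (suc s)) ⊕ qInt (suc N))     ≈⟨ ⋆-congˡ M (λ i → trans (+-comm _ (qInt (suc N) i)) (sym (qInt-+ (suc N) (suc s) i))) ⟩
  M ⋆ qInt (suc N + suc s)                              ≈⟨ qFact-suc (N + suc s) ⟨
  qFact (suc N + suc s)                                 ∎
  where
  open SetoidReasoning (ℕ →-setoid ℕ)
  G G′ S′ N′ M : Poly
  G  = gauss s (suc N)
  G′ = gauss (suc s) N
  S′ = qFact (suc s)
  N′ = qFact (suc N)
  M  = qFact (N + suc s)

  left : shift (suc N) G ⋆ (S′ ⋆ N′) ≗ M ⋆ shift (suc N) (qInt (suc s))
  left = begin
    shift (suc N) G ⋆ (S′ ⋆ N′)                        ≈⟨ shift-⋆ (suc N) G (S′ ⋆ N′) ⟩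
    shift (suc N) (G ⋆ (S′ ⋆ N′))                      ≈⟨ shift-cong (suc N) (begin
      G ⋆ (S′ ⋆ N′)                                       ≈⟨ ⋆-congˡ G (⋆-congʳ N′ (qFact-suc s)) ⟩
      G ⋆ (qFact s ⋆ qInt (suc s) ⋆ N′)                   ≈⟨ ⋆-congˡ G (⋆-assoc (qFact s) (qInt (suc s)) N′) ⟩
      G ⋆ (qFact s ⋆ (qInt (suc s) ⋆ N′))                 ≈⟨ ⋆-congˡ G (⋆-congˡ (qFact s) (⋆-comm (qInt (suc s)) N′)) ⟩
      G ⋆ (qFact s ⋆ (N′ ⋆ qInt (suc s)))                 ≈⟨ ⋆-congˡ G (⋆-assoc (qFact s) N′ (qInt (suc s))) ⟨
      G ⋆ (qFact s ⋆ N′ ⋆ qInt (suc s))                   ≈⟨ ⋆-assoc G (qFact s ⋆ N′) (qInt (suc s)) ⟨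
      G ⋆ (qFact s ⋆ N′) ⋆ qInt (suc s)                   ≈⟨ ⋆-congʳ (qInt (suc s)) (gauss-qFact s (suc N)) ⟩
      qFact (suc N + s) ⋆ qInt (suc s)                    ≡⟨ cong (λ a → qFact a ⋆ qInt (suc s)) (+-suc N s) ⟨
      M ⋆ qInt (suc s)                                    ∎) ⟩
    shift (suc N) (M ⋆ qInt (suc s))                   ≈⟨ ⋆-shift (suc N) M (qInt (suc s)) ⟨
    M ⋆ shift (suc N) (qInt (suc s))                   ∎

  right : G′ ⋆ (S′ ⋆ N′) ≗ M ⋆ qInt (suc N)
  right = begin
    G′ ⋆ (S′ ⋆ N′)                       ≈⟨ ⋆-congˡ G′ (⋆-congˡ S′ (qFact-suc N)) ⟩
    G′ ⋆ (S′ ⋆ (qFact N ⋆ qInt (suc N))) ≈⟨ ⋆-congˡ G′ (⋆-assoc S′ (qFact N) (qInt (suc N))) ⟨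
    G′ ⋆ (S′ ⋆ qFact N ⋆ qInt (suc N))   ≈⟨ ⋆-assoc G′ (S′ ⋆ qFact N) (qInt (suc N)) ⟨
    G′ ⋆ (S′ ⋆ qFact N) ⋆ qInt (suc N)   ≈⟨ ⋆-congʳ (qInt (suc N)) (gauss-qFact (suc s) N) ⟩
    M ⋆ qInt (suc N)                     ∎

-- Counting critical words

-- The counterpart of `shift` for lists: it raises the excess by c.
delay : ℕ → (ℕ → List Word) → ℕ → List Word
delay zero    F i       = F i
delay (suc c) F zero    = []
delay (suc c) F (suc i) = delay c F i

-- criticals m d N i lists the critical words that continue a word with maximum m, raise the maximum d times
-- and contain N further letters of total excess i.
mutual
  criticals : (m d N i : ℕ) → List Word
  criticals m d N i = risers m d N i ++ repeaters m d N i

  risers : (m d N i : ℕ) → List Word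
  risers m zero    zero    zero    = [ [] ]
  risers m zero    zero    (suc i) = []
  risers m zero    (suc N) i       = []
  risers m (suc d) N       i       = map (suc m ∷_) (criticals (suc m) d N i)

  repeaters : (m d N i : ℕ) → List Word
  repeaters m d zero    i = []
  repeaters m d (suc N) i =
    if evenᵇ m then [] else delay (m ∸ 1) (λ i → map (m ∷_) (criticals m d N i)) i

∈-delay⁺ : ∀ c {F i w} → w ∈ F i → w ∈ delay c F (c + i)
∈-delay⁺ zero    w∈ = w∈
∈-delay⁺ (suc c) w∈ = ∈-delay⁺ c w∈

∈-delay⁻ : ∀ c {F i w} → w ∈ delay c F i → Σ[ i′ ∈ ℕ ] (c + i′ ≡ i × w ∈ F i′)
∈-delay⁻ zero            w∈ = _ , refl , w∈
∈-delay⁻ (suc c) {i = suc i} w∈ with ∈-delay⁻ c w∈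
... | i′ , refl , w∈F = i′ , refl , w∈F

delay-unique : ∀ c {F} → (∀ i → Unique (F i)) → ∀ i → Unique (delay c F i)
delay-unique zero    u i       = u i
delay-unique (suc c) u zero    = []
delay-unique (suc c) u (suc i) = delay-unique c u i

length-delay : ∀ c F → length ∘ delay c F ≗ shift c (length ∘ F)
length-delay zero    F i       = refl
length-delay (suc c) F zero    = refl
length-delay (suc c) F (suc i) = length-delay c F i

RG-≤ : ∀ {m k n i w} → RG m k n i w → m ≤ k
RG-≤ end       = ≤-refl
RG-≤ (new r)   = <⇒≤ (RG-≤ r)
RG-≤ (old _ r) = RG-≤ r

RG-≥ : ∀ {m k n i w} → RG m k n i w → k ≤ m + n
RG-≥ {m} end                 = m≤m+n m 0
RG-≥ {m} (new {n = n} r)     = ≤-trans (RG-≥ r) (≤-reflexive (sym (+-suc m n)))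
RG-≥ {m} (old {n = n} _ r)   = ≤-trans (RG-≥ r) (+-monoʳ-≤ m (n≤1+n n))

mutual
  ∈-criticals⁻ : ∀ {m k n} d N {i w} → m + d ≡ k → d + N ≡ n → w ∈ criticals m d N i →
                 RG m k n i w × criticalᵇ m w ≡ true
  ∈-criticals⁻ {m} d N {i} p q w∈ with ∈-++⁻ (risers m d N i) w∈
  ... | inj₁ w∈′ = ∈-risers⁻ d N p q w∈′
  ... | inj₂ w∈′ = ∈-repeaters⁻ d N p q w∈′

  ∈-risers⁻ : ∀ {m k n} d N {i w} → m + d ≡ k → d + N ≡ n → w ∈ risers m d N i →
              RG m k n i w × criticalᵇ m w ≡ true
  ∈-risers⁻ {m} zero zero {zero} refl refl (here refl) =
    subst (λ k → RG m k 0 0 []) (sym (+-identityʳ m)) end , refl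
  ∈-risers⁻ {m} (suc d) N refl refl w∈ with ∈-map⁻ (suc m ∷_) w∈
  ... | u , u∈ , refl rewrite kind-new m | m⊔1+m m with ∈-criticals⁻ d N (sym (+-suc m d)) refl u∈
  ...   | r , c = new r , c

  ∈-repeaters⁻ : ∀ {m k n} d N {i w} → m + d ≡ k → d + N ≡ n → w ∈ repeaters m d N i →
                 RG m k n i w × criticalᵇ m w ≡ true
  ∈-repeaters⁻ {m} {k} d (suc N) p refl w∈ with evenᵇ m in odd
  -- The maximum 0 is excluded as even; a repeated maximum a + 1 adds excess a, which is the delay
  -- `m ∸ 1`.
  ∈-repeaters⁻ {zero}  d (suc N) p refl () | true
  ∈-repeaters⁻ {suc a} {k} d (suc N) p refl w∈ | false with ∈-delay⁻ a w∈
  ... | i , refl , w∈F with ∈-map⁻ (suc a ∷_) w∈F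
  ...   | u , u∈ , refl rewrite kind-≡ {suc a} (is-top odd) | ⊔-idem a with ∈-criticals⁻ d N p refl u∈
  ...     | r , c = subst (λ n → RG (suc a) k n (a + i) (suc a ∷ u)) (sym (+-suc d N)) (old ≤-refl r) , c

∈-repeaters⁺ : ∀ {a i w} d N → evenᵇ (suc a) ≡ false → w ∈ criticals (suc a) d N i →
               suc a ∷ w ∈ repeaters (suc a) d (suc N) (a + i)
∈-repeaters⁺ {a} d N odd w∈ rewrite odd = ∈-delay⁺ a (∈-map⁺ (suc a ∷_) w∈)

∈-criticals⁺ : ∀ {m k n i w} d N → m + d ≡ k → d + N ≡ n → RG m k n i w → criticalᵇ m w ≡ true →
               w ∈ criticals m d N i
∈-criticals⁺ {m} d N p q end c with m+n≡0⇒m≡0 d q | m+n≡0⇒n≡0 d q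
... | refl | refl = here refl
∈-criticals⁺ {m} zero N p q (new r) c =
  contradiction (≤-trans (RG-≤ r) (≤-reflexive (trans (sym p) (+-identityʳ m)))) (<-irrefl refl)
∈-criticals⁺ {m} (suc d) N p q (new r) c rewrite kind-new m | m⊔1+m m =
  ∈-++⁺ˡ (∈-map⁺ (suc m ∷_) (∈-criticals⁺ d N (trans (sym (+-suc m d)) p) (suc-injective q) r c))
-- With N = 0 every remaining letter has to raise the maximum; an old letter leaves too few to reach
-- k.
∈-criticals⁺ {m} {k} d zero p q (old {n = n} a<m r) c = contradiction (RG-≥ r) (<⇒≱ (begin-strict
  m + n      <⟨ +-monoʳ-< m (n<1+n n) ⟩
  m + suc n  ≡⟨ cong (m +_) (trans (sym q) (+-identityʳ d)) ⟩
  m + d      ≡⟨ p ⟩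
  k          ∎))
  where open ≤-Reasoning
∈-criticals⁺ {m} d (suc N) p q (old {i = i} {a = a} a<m r) c with kind m (suc a) in e
... | critical rewrite m≥n⇒m⊔n≡m a<m with kind-view e
...   | is-fresh m<1+a = contradiction (<-≤-trans m<1+a a<m) (<-irrefl refl)
...   | is-top odd = ∈-++⁺ʳ (risers (suc a) d (suc N) (a + i))
        (∈-repeaters⁺ d N odd (∈-criticals⁺ d N p (suc-injective (trans (sym (+-suc d N)) q)) r c))

mutual
  -- The two parts differ in the first letter, m + 1 or m; within a part the tails are distinct by
  -- induction.
  criticals-unique : ∀ m d N i → Unique (criticals m d N i)
  criticals-unique m d N i =
    Unique.++⁺ (risers-unique m d N i) (repeaters-unique m d N i) (λ (p , q) → disjoint d N i p q)
    where
    disjoint : ∀ d N i {w} → w ∈ risers m d N i → w ∈ repeaters m d N i → ⊥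
    disjoint (suc d) (suc N) i p q with ∈-map⁻ (suc m ∷_) p
    ... | _ , _ , refl with evenᵇ m
    ...   | false with ∈-delay⁻ (m ∸ 1) q
    ...     | _ , _ , q′ with ∈-map⁻ (m ∷_) q′
    ...       | _ , _ , ()

  risers-unique : ∀ m d N i → Unique (risers m d N i)
  risers-unique m zero    zero    zero    = [] ∷ []
  risers-unique m zero    zero    (suc i) = []
  risers-unique m zero    (suc N) i       = []
  risers-unique m (suc d) N       i       = Unique.map⁺ ∷-injectiveʳ (criticals-unique (suc m) d N i)

  repeaters-unique : ∀ m d N i → Unique (repeaters m d N i)
  repeaters-unique m d zero    i = []
  repeaters-unique m d (suc N) i with evenᵇ m
  ... | true  = []
  ... | false = delay-unique (m ∸ 1) (λ i → Unique.map⁺ ∷-injectiveʳ (criticals-unique m d N i)) i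

-- Both lists are free of repetitions and have the same members, so they are permutations of each
-- other.
length-W : ∀ k N i → length (W (k + N) k i) ≡ length (criticals 0 k N i)
length-W k N i = ↭-length (∼bag⇒↭ (unique∧set⇒bag (W-unique (k + N) k i) (criticals-unique 0 k N i) (mk⇔ to from)))
  where
  to : ∀ {w} → w ∈ W (k + N) k i → w ∈ criticals 0 k N i
  to w∈W = ∈-criticals⁺ k N refl refl (proj₁ facts) (proj₂ facts)
    where facts = ∈W⇒critical (k + N) k i w∈W

  from : ∀ {w} → w ∈ criticals 0 k N i → w ∈ W (k + N) k i
  from w∈ = critical⇒∈W (proj₁ facts) (proj₂ facts)
    where facts = ∈-criticals⁻ k N refl refl w∈

count : (m d N : ℕ) → Poly
count m d N i = length (criticals m d N i)

evenᵇ-*2 : ∀ p → evenᵇ (p * 2) ≡ true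
evenᵇ-*2 zero    = refl
evenᵇ-*2 (suc p) = evenᵇ-*2 p

count-suc : ∀ m d N i → count m (suc d) N i ≡ count (suc m) d N i + length (repeaters m (suc d) N i)
count-suc m d N i = trans (length-++ (risers m (suc d) N i))
  (cong (_+ length (repeaters m (suc d) N i)) (length-map (suc m ∷_) (criticals (suc m) d N i)))

-- No letter can repeat an even maximum, so the next letter must raise it.
count-even : ∀ m d N → evenᵇ m ≡ true → count m (suc d) N ≗ count (suc m) d N
count-even m d N even i = begin
  count m (suc d) N i                                           ≡⟨ count-suc m d N i ⟩
  count (suc m) d N i + length (repeaters m (suc d) N i)  ≡⟨ cong (λ L → count (suc m) d N i + length L) (none N) ⟩
  count (suc m) d N i + 0                                       ≡⟨ +-identityʳ _ ⟩
  count (suc m) d N i                                           ∎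
  where
  open ≡-Reasoning
  none : ∀ N → repeaters m (suc d) N i ≡ []
  none zero    = refl
  none (suc N) rewrite even = refl

-- One more repetition of 2p + 1 adds excess 2p, which turns the exponent 2pN into 2p(N + 1).
length-repeaters : ∀ p d N {f} → count (suc (p * 2)) d N ≗ shift (p * N * 2) f →
                   length ∘ repeaters (suc (p * 2)) d (suc N) ≗ shift (p * suc N * 2) f
length-repeaters p d N {f} eq i rewrite evenᵇ-suc (p * 2) | evenᵇ-*2 p = begin
  length (delay (p * 2) (λ i → map (suc (p * 2) ∷_) (criticals (suc (p * 2)) d N i)) i)
    ≡⟨ length-delay (p * 2) _ i ⟩
  shift (p * 2) (λ i → length (map (suc (p * 2) ∷_) (criticals (suc (p * 2)) d N i))) i
    ≡⟨ shift-cong (p * 2) (λ i → trans (length-map (suc (p * 2) ∷_) (criticals (suc (p * 2)) d N i)) (eq i)) i ⟩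
  shift (p * 2) (shift (p * N * 2) f) i
    ≡⟨ shift-shift (p * 2) (p * N * 2) f i ⟨
  shift (p * 2 + p * N * 2) f i
    ≡⟨ cong (λ c → shift c f i) (exponent p N) ⟩
  shift (p * suc N * 2) f i ∎
  where
  open ≡-Reasoning
  exponent : ∀ p N → p * 2 + p * N * 2 ≡ p * suc N * 2
  exponent = solve-∀

gauss-zero : ∀ s → gauss s 0 ≡ onePoly
gauss-zero zero    = refl
gauss-zero (suc s) = refl

half-suc-suc : ∀ d → (2 + d) / 2 ≡ suc (d / 2)
half-suc-suc d = +-distrib-/-∣ˡ {2} d (divides 1 refl)

-- Either 2p + 1 is repeated, or 2p + 2 and 2p + 3 follow and use up two raises. In the second case
-- each of the N + 1 letters gains a further factor x = q²; with x^(p(N + 1)) taken out, this is the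
-- recursion of `gauss`.
count-odd-step : ∀ p d N →
                 count (suc (suc p * 2)) d (suc N) ≗ shift (suc p * suc N * 2) (sq (gauss (d / 2) (suc N))) →
                 count (suc (p * 2)) (2 + d) N ≗ shift (p * N * 2) (sq (gauss ((2 + d) / 2) N)) →
                 count (suc (p * 2)) (2 + d) (suc N) ≗ shift (p * suc N * 2) (sq (gauss ((2 + d) / 2) (suc N)))
count-odd-step p d N risen repeated-N i rewrite half-suc-suc d = begin
  count (suc (p * 2)) (2 + d) (suc N) i
    ≡⟨ count-suc (suc (p * 2)) (suc d) (suc N) i ⟩
  count (2 + p * 2) (suc d) (suc N) i + length (repeaters (suc (p * 2)) (2 + d) (suc N) i)
    ≡⟨ cong₂ _+_ (trans (count-even (2 + p * 2) d (suc N) (evenᵇ-*2 p) i) (risen i))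
                 (length-repeaters p (2 + d) N repeated-N i) ⟩
  shift (suc p * suc N * 2) (sq G) i + shift (p * suc N * 2) (sq G′) i
    ≡⟨ cong (_+ shift (p * suc N * 2) (sq G′) i) (begin
      shift (suc p * suc N * 2) (sq G) i                ≡⟨ cong (λ c → shift c (sq G) i) (exponent p N) ⟩
      shift (p * suc N * 2 + suc N * 2) (sq G) i        ≡⟨ shift-shift (p * suc N * 2) (suc N * 2) (sq G) i ⟩
      shift (p * suc N * 2) (shift (suc N * 2) (sq G)) i ≡⟨ shift-cong (p * suc N * 2) (sq-shift (suc N) G) i ⟨
      shift (p * suc N * 2) (sq (shift (suc N) G)) i    ∎) ⟩
  shift (p * suc N * 2) (sq (shift (suc N) G)) i + shift (p * suc N * 2) (sq G′) i
    ≡⟨ shift-⊕ (p * suc N * 2) (sq (shift (suc N) G)) (sq G′) i ⟨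
  shift (p * suc N * 2) (sq (shift (suc N) G) ⊕ sq G′) i
    ≡⟨ shift-cong (p * suc N * 2) (sq-⊕ (shift (suc N) G) G′) i ⟨
  shift (p * suc N * 2) (sq (shift (suc N) G ⊕ G′)) i ∎
  where
  open ≡-Reasoning
  G G′ : Poly
  G  = gauss (d / 2) (suc N)
  G′ = gauss (suc (d / 2)) N

  exponent : ∀ p N → suc p * suc N * 2 ≡ p * suc N * 2 + suc N * 2
  exponent = solve-∀

-- A letter 2p + 1 has excess 2p, so N letters that are at least as large have weight divisible by q^(2pN).
count-odd : ∀ p d N → count (suc (p * 2)) d N ≗ shift (p * N * 2) (sq (gauss (d / 2) N))
count-odd p zero zero i rewrite *-zeroʳ p = trans (one i) (sym (sq-onePoly i))
  where
  one : count (suc (p * 2)) 0 0 ≗ onePoly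
  one zero    = refl
  one (suc i) = refl
count-odd p zero (suc N) i = length-repeaters p 0 N (count-odd p 0 N) i
count-odd p (suc zero) zero i rewrite *-zeroʳ p = trans (one i) (sym (sq-onePoly i))
  where
  one : count (suc (p * 2)) 1 0 ≗ onePoly
  one zero    = refl
  one (suc i) = refl
count-odd p (suc zero) (suc N) i = begin
  count (suc (p * 2)) 1 (suc N) i
    ≡⟨ count-suc (suc (p * 2)) 0 (suc N) i ⟩
  length (repeaters (2 + p * 2) 0 (suc N) i) + length (repeaters (suc (p * 2)) 1 (suc N) i)
    -- The only raise leads to the even maximum 2p + 2, where none of the N + 1 letters left can be
    -- placed.
    ≡⟨ cong₂ _+_ none (length-repeaters p 1 N (count-odd p 1 N) i) ⟩
  shift (p * suc N * 2) (sq onePoly) i ∎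
  where
  open ≡-Reasoning
  none : length (repeaters (2 + p * 2) 0 (suc N) i) ≡ 0
  none rewrite evenᵇ-*2 p = refl
count-odd p (suc (suc d)) zero i = begin
  count (suc (p * 2)) (2 + d) 0 i                 ≡⟨ count-suc (suc (p * 2)) (suc d) 0 i ⟩
  count (2 + p * 2) (suc d) 0 i + 0               ≡⟨ +-identityʳ _ ⟩
  count (2 + p * 2) (suc d) 0 i                   ≡⟨ count-even (2 + p * 2) d 0 (evenᵇ-*2 p) i ⟩
  count (suc (suc p * 2)) d 0 i                   ≡⟨ count-odd (suc p) d 0 i ⟩
  shift (p * 0 * 2) (sq (gauss (d / 2) 0)) i
    ≡⟨ cong (λ g → shift (p * 0 * 2) (sq g) i) (trans (gauss-zero (d / 2)) (sym (gauss-zero ((2 + d) / 2)))) ⟩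
  shift (p * 0 * 2) (sq (gauss ((2 + d) / 2) 0)) i ∎
  where open ≡-Reasoning
count-odd p (suc (suc d)) (suc N) =
  count-odd-step p d N (count-odd (suc p) d (suc N)) (count-odd p (suc (suc d)) N)

-- The Hilbert series

poincare-gauss : ∀ d N → poincare (suc d + N) (suc d) ≗ sq (gauss (d / 2) N)
poincare-gauss d N i = begin
  poincare (suc d + N) (suc d) i  ≡⟨ length-W (suc d) N i ⟩
  -- The maximum 0 is even, so the word starts with 1; then `count-odd` applies with p = 0.
  count 0 (suc d) N i             ≡⟨ count-even 0 d N refl i ⟩
  count 1 d N i                   ≡⟨ count-odd 0 d N i ⟩
  sq (gauss (d / 2) N) i          ∎
  where open ≡-Reasoning

half+half : ∀ d → suc d / 2 + d / 2 ≡ d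
half+half zero          = refl
half+half (suc zero)    = refl
half+half (suc (suc d)) = begin
  (3 + d) / 2 + (2 + d) / 2          ≡⟨ cong₂ _+_ (half-suc-suc (suc d)) (half-suc-suc d) ⟩
  suc (suc d / 2) + suc (d / 2)      ≡⟨ cong suc (+-suc (suc d / 2) (d / 2)) ⟩
  2 + (suc d / 2 + d / 2)            ≡⟨ cong (2 +_) (half+half d) ⟩
  2 + d                              ∎
  where open ≡-Reasoning

-- Rounding d / 2 up and down gives two halves that add up to d. With d = k - 1 and N = n - k, the
-- upper index of the statement's binomial becomes N + d / 2 and its complementary factorial that of
-- N.
top-index : ∀ d N → d + N ∸ suc d / 2 ≡ N + d / 2
top-index d N = begin
  d + N ∸ suc d / 2                        ≡⟨ cong (λ x → x + N ∸ suc d / 2) (half+half d) ⟨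
  suc d / 2 + d / 2 + N ∸ suc d / 2        ≡⟨ cong (_∸ suc d / 2) (+-assoc (suc d / 2) (d / 2) N) ⟩
  suc d / 2 + (d / 2 + N) ∸ suc d / 2      ≡⟨ m+n∸m≡n (suc d / 2) (d / 2 + N) ⟩
  d / 2 + N                                ≡⟨ +-comm (d / 2) N ⟩
  N + d / 2                                ∎
  where open ≡-Reasoning

-- The substitution x = q² is multiplicative, so `gauss-qFact` carries over.
poincare-qBinomial : ∀ d N m →
  (poincare (suc d + N) (suc d) ⊛ (sq (qFact (d / 2)) ⊛ sq (qFact ((d + N ∸ suc d / 2) ∸ d / 2)))) m
  ≡ sq (qFact (d + N ∸ suc d / 2)) m
poincare-qBinomial d N rewrite top-index d N | m+n∸n≡m N (d / 2) = begin
  poincare (suc d + N) (suc d) ⊛ (S₁ ⊛ S₂)  ≈⟨ ⊛≗⋆ (poincare (suc d + N) (suc d)) (S₁ ⊛ S₂) ⟩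
  poincare (suc d + N) (suc d) ⋆ (S₁ ⊛ S₂)  ≈⟨ ⋆-cong (poincare-gauss d N) (⊛≗⋆ S₁ S₂) ⟩
  sq G ⋆ (S₁ ⋆ S₂)                          ≈⟨ ⋆-congˡ (sq G) (sq-⋆ (qFact (d / 2)) (qFact N)) ⟨
  sq G ⋆ sq (qFact (d / 2) ⋆ qFact N)     ≈⟨ sq-⋆ G (qFact (d / 2) ⋆ qFact N) ⟨
  sq (G ⋆ (qFact (d / 2) ⋆ qFact N))      ≈⟨ sq-cong (gauss-qFact (d / 2) N) ⟩
  sq (qFact (N + d / 2))                  ∎
  where
  open SetoidReasoning (ℕ →-setoid ℕ)
  G S₁ S₂ : Poly
  G  = gauss (d / 2) N
  S₁ = sq (qFact (d / 2))
  S₂ = sq (qFact N)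

-- Existence and uniqueness of `c` together say that the classes of the words in `W n k i` form a
-- ℤ-basis of the homology in rank i. The Gaussian binomial appears with its denominator multiplied
-- out.
theorem6p3 : (n k : ℕ) → 1 ≤ n → 1 ≤ k → k ≤ n → (i : ℕ) →
    ((j : Fin (length (W n k i))) → ∀ v → coeffIn v (∂word (lookup (W n k i) j)) ≡ ℤ.pos 0)
    × ((z : Coeffs (B n k i)) → IsCycle n k i z →
    Σ[ c ∈ Coeffs (W n k i) ]
    (Homologous n k i (toFun (B n k i) z) (toFun (W n k i) c)
    × ((c′ : Coeffs (W n k i)) →
    Homologous n k i (toFun (B n k i) z) (toFun (W n k i) c′) →
    ∀ j → c j ≡ c′ j)))
    × (∀ m → (poincare n k ⊛ (sq (qFact ((k ∸ 1) / 2)) ⊛ sq (qFact ((n ∸ 1 ∸ k / 2) ∸ (k ∸ 1) / 2)))) m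
    ≡ sq (qFact (n ∸ 1 ∸ k / 2)) m)
theorem6p3 n (suc d) 1≤n 1≤k k≤n i = critical-cycle n k i , homology , hilbert
  where
  k = suc d

  homology : (z : Coeffs (B n k i)) → IsCycle n k i z →
             Σ[ c ∈ Coeffs (W n k i) ]
               (Homologous n k i (toFun (B n k i) z) (toFun (W n k i) c)
                × ((c′ : Coeffs (W n k i)) →
                   Homologous n k i (toFun (B n k i) z) (toFun (W n k i) c′) → ∀ j → c j ≡ c′ j))
  homology z cycle = retract n k i z , cycle-homologous n k i z cycle , λ c′ hom j →
    -- Both coefficient vectors equal the restriction of z to the critical words.
    trans (homologous-coefficient n k i z (retract n k i z) (cycle-homologous n k i z cycle) j)
          (sym (homologous-coefficient n k i z c′ hom j))

  hilbert : ∀ m → (poincare n k ⊛ (sq (qFact (d / 2)) ⊛ sq (qFact ((n ∸ 1 ∸ k / 2) ∸ d / 2)))) m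
                  ≡ sq (qFact (n ∸ 1 ∸ k / 2)) m
  -- The count is indexed by N = n - k, so n is written as k + (n - k).
  hilbert = subst (λ n → ∀ m → (poincare n k ⊛ (sq (qFact (d / 2)) ⊛ sq (qFact ((n ∸ 1 ∸ k / 2) ∸ d / 2)))) m
                               ≡ sq (qFact (n ∸ 1 ∸ k / 2)) m)
                  (m+[n∸m]≡n k≤n) (poincare-qBinomial d (n ∸ k))
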